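{- Let $m\geqslant1$ and $n\geqslant 1$ be integers. Let $${}^{(m)}\mathrm{Sh}_{1,n-1}=\left(1+s_{n-1}+s_{n-2}s_{n-1}+\dots+s_1s_2\cdots s_{n-1}\right)\left(1+t_n+t_n^2+\dots+t_n^{m-1}\right)\in\mathbb{Z}G(m,1,n),$$ and let $P$ be the matrix, with rows and columns indexed by the elements of $G(m,1,n)$, obtained by dividing by $mn$ the matrix, in the basis of group elements, of the operator $y\mapsto {}^{(m)}\mathrm{Sh}_{1,n-1}\,y$ of left multiplication on the group algebra. Then $P$ is a doubly stochastic matrix of transition probabilities, the underlying Markov chain is ergodic, and its unique stationary probability distribution is uniform. Moreover, the convergence to stationarity occurs exponentially fast, with the rate governed by the second largest eigenvalue: there exists a constant $\alpha>0$ such that for all integers $k\geqslant1$ and all indices $i,j$, $$\left|(P^k)_{ij}-\frac{1}{m^n n!}\right|\leqslant\begin{cases}\alpha\left(\frac{n-2}{n}\right)^k & \text{if } m=1,\\[4pt] \alpha\left(\frac{n-1}{n}\right)^k & \text{if } m>1.\end{cases}$$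
   Context: Let $C_m$ be the cyclic group of order $m$ with generator $\gamma$, and let $E=\{(x,\rho): x\in\{1,\dots,n\},\ \rho\in C_m\}$, with $C_m$ acting on $E$ by $\rho\cdot(x,\rho')=(x,\rho\rho')$. The complex reflection group $G(m,1,n)$ is identified with the group of all permutations $\pi$ of the set $E$ such that $\pi(x,\rho)=\rho\cdot\pi(x,1)$ for all $x\in\{1,\dots,n\}$, $\rho\in C_m$. It has order $m^n n!$. The elements $s_1,\dots,s_{n-1},t$ of $G(m,1,n)$ are given by $s_i(x,1)=(\pi_i(x),1)$, where $\pi_i$ is the transposition $(i,i+1)$, and $t(1,1)=(1,\gamma)$, $t(x,1)=(x,1)$ for $x\neq1$. One sets $t_1=t$ and $t_{i+1}=s_it_is_i$ for $i=1,\dots,n-1$. The element ${}^{(m)}\mathrm{Sh}_{1,n-1}$ is a sum of $mn$ distinct group elements, and the Markov chain with transition matrix $P$ corresponds to repeated shuffles of a deck of $n$ polygonal cards, each shuffle being randomly picked among these $mn$ elements.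
   Formalization: For m = 1 the bound is stated only for n ≥ 2, since at m = n = 1 it would read 0 ≤ α(-1)^k, false for odd k; the remark that the rate is governed by the second largest eigenvalue is rendered only by the displayed bound. -}

module Defs where

open import Algebra.Bundles using (Group)
import Algebra.Definitions.RawSemiring as RawSemiring
import Algebra.Properties.Group as GroupProperties
open import Data.Bool.Base using (if_then_else_)
open import Data.Fin.Base as Fin using (Fin; toℕ)
import Data.Fin.Properties as Fin
open import Data.Fin.Permutation as Perm
  using (Permutation′; permutation; _⟨$⟩ʳ_; _⟨$⟩ˡ_)
open import Data.Integer.Base as ℤ using (ℤ; +_)
open import Data.List.Base as List
  using (List; []; _∷_; _++_; foldr; map; allFin; upTo; cartesianProductWith)
import Data.List.Membership.Propositional.Properties as List∈
import Data.List.Membership.Setoid.Properties as Setoid∈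
import Data.List.Relation.Unary.All as All
import Data.List.Relation.Unary.AllPairs as AllPairs
open import Data.List.Relation.Unary.Any using (here)
open import Data.List.Relation.Unary.Enumerates.Setoid using (IsEnumeration)
open import Data.List.Relation.Unary.Unique.Setoid using (Unique)
import Data.List.Relation.Unary.Unique.Propositional.Properties as List!
import Data.List.Relation.Unary.Unique.Setoid.Properties as Setoid!
open import Data.Nat.Base as ℕ using (ℕ; zero; suc; NonZero; _∸_; _!)
open import Data.Nat.Divisibility using (_∣_)
open import Data.Nat.DivMod
  using (_%_; _mod_; m<n⇒m%n≡m; m%n<n; %-distribˡ-+; m%n%n≡m%n; n%n≡0)
import Data.Nat.Properties as ℕ
open import Data.Product.Base using (∃-syntax; _×_; _,_; proj₁; proj₂; uncurry)
open import Data.Product.Properties using (≡-dec)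
open import Data.Rational.Base as ℚ
  using (ℚ; 0ℚ; 1ℚ; ½; _+_; _-_; _*_; -_; _≤_; _<_; ∣_∣; positive; 1/_)
import Data.Rational.Properties as ℚ
open import Data.Rational.Solver using (module +-*-Solver)
open import Data.Vec.Base as Vec using (Vec; []; _∷_; lookup; tabulate)
open import Data.Vec.Properties using (∷-injective; lookup∘tabulate; tabulate∘lookup; tabulate-cong)
open import Function.Bundles using (_↔_; Inverse; mk↔ₛ′)
open import Function.Construct.Composition using (_↔-∘_)
open import Function.Construct.Identity using (↔-id)
open import Function.Construct.Symmetry using (↔-sym)
open import Level using (0ℓ)
open import Relation.Binary.Bundles using (Setoid; DecSetoid)
open import Relation.Binary.Definitions using (Decidable)
open import Relation.Binary.PropositionalEquality
  using (_≡_; refl; sym; trans; cong; cong₂; subst; setoid; isEquivalence; module ≡-Reasoning)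
open import Relation.Nullary.Decidable using (does; map′)

-- Real numbers as Cauchy sequences of rationals.  They are needed only
-- as the values of probability distributions: the entries of the
-- transition matrices below are rational.

record ℝ : Set where
  constructor mkℝ
  field
    seq    : ℕ → ℚ
    cauchy : ∀ ε → 0ℚ < ε →
             ∃[ N ] (∀ k l → N ℕ.≤ k → N ℕ.≤ l → ∣ seq k - seq l ∣ < ε)

open ℝ public

infix 4 _≃_
_≃_ : ℝ → ℝ → Set
x ≃ y = ∀ ε → 0ℚ < ε → ∃[ N ] (∀ k → N ℕ.≤ k → ∣ seq x k - seq y k ∣ < ε)

NonNegativeℝ : ℝ → Set
NonNegativeℝ x = ∀ ε → 0ℚ < ε → ∃[ N ] (∀ k → N ℕ.≤ k → - ε < seq x k)

private
  Cauchy : (ℕ → ℚ) → Set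
  Cauchy u = ∀ ε → 0ℚ < ε →
    ∃[ N ] (∀ k l → N ℕ.≤ k → N ℕ.≤ l → ∣ u k - u l ∣ < ε)

  abstract
    constant-cauchy : ∀ q → Cauchy (λ _ → q)
    constant-cauchy q ε 0<ε =
      0 , λ _ _ _ _ → subst (_< ε) (sym (cong ∣_∣ (ℚ.+-inverseʳ q))) 0<ε

    +-cauchy : ∀ u v → Cauchy u → Cauchy v → Cauchy (λ k → u k + v k)
    +-cauchy u v u-cauchy v-cauchy ε 0<ε =
      let
        0<½ε    = subst (_< ½ * ε) (ℚ.*-zeroʳ ½) (ℚ.*-monoʳ-<-pos ½ 0<ε)
        M , ∣u∣ = u-cauchy (½ * ε) 0<½ε
        N , ∣v∣ = v-cauchy (½ * ε) 0<½ε
      in M ℕ.⊔ N , λ k l M⊔N≤k M⊔N≤l → let open ℚ.≤-Reasoning in begin-strict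
        ∣ u k + v k - (u l + v l) ∣
          ≡⟨ cong ∣_∣ (rearrange (u k) (v k) (u l) (v l)) ⟩
        ∣ u k - u l + (v k - v l) ∣
          ≤⟨ ℚ.∣p+q∣≤∣p∣+∣q∣ (u k - u l) (v k - v l) ⟩
        ∣ u k - u l ∣ + ∣ v k - v l ∣
          <⟨ ℚ.+-mono-<
               (∣u∣ k l (ℕ.m⊔n≤o⇒m≤o M N M⊔N≤k) (ℕ.m⊔n≤o⇒m≤o M N M⊔N≤l))
               (∣v∣ k l (ℕ.m⊔n≤o⇒n≤o M N M⊔N≤k) (ℕ.m⊔n≤o⇒n≤o M N M⊔N≤l)) ⟩
        ½ * ε + ½ * ε
          ≡⟨ ℚ.*-distribʳ-+ ε ½ ½ ⟨
        1ℚ * ε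
          ≡⟨ ℚ.*-identityˡ ε ⟩
        ε ∎
      where
      open +-*-Solver
      rearrange : ∀ a b c d → a + b - (c + d) ≡ a - c + (b - d)
      rearrange = solve 4 (λ a b c d → a :+ b :- (c :+ d) := a :- c :+ (b :- d)) refl

    ·-cauchy : ∀ q u → Cauchy u → Cauchy (λ k → q * u k)
    ·-cauchy q u u-cauchy ε 0<ε =
      let
        N , ∣u∣ = u-cauchy (1/c * ε)
                    (subst (_< 1/c * ε) (ℚ.*-zeroʳ 1/c) (ℚ.*-monoʳ-<-pos 1/c 0<ε))
      in N , λ k l N≤k N≤l → let open ℚ.≤-Reasoning in begin-strict
        ∣ q * u k - q * u l ∣
          ≡⟨ cong ∣_∣ (factor q (u k) (u l)) ⟩
        ∣ q * (u k - u l) ∣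
          ≡⟨ ℚ.∣p*q∣≡∣p∣*∣q∣ q (u k - u l) ⟩
        ∣ q ∣ * ∣ u k - u l ∣
          ≤⟨ ℚ.*-monoʳ-≤-nonNeg ∣ u k - u l ∣ {{ℚ.∣-∣-nonNeg (u k - u l)}} (ℚ.<⇒≤ ∣q∣<c) ⟩
        c * ∣ u k - u l ∣
          <⟨ ℚ.*-monoʳ-<-pos c (∣u∣ k l N≤k N≤l) ⟩
        c * (1/c * ε)
          ≡⟨ ℚ.*-assoc c 1/c ε ⟨
        c * 1/c * ε
          ≡⟨ cong (_* ε) (ℚ.*-inverseʳ c) ⟩
        1ℚ * ε
          ≡⟨ ℚ.*-identityˡ ε ⟩
        ε ∎
      where
      open +-*-Solver
      factor : ∀ a b c → a * b - a * c ≡ a * (b - c)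
      factor = solve 3 (λ a b c → a :* b :- a :* c := a :* (b :- c)) refl

      c : ℚ
      c = ∣ q ∣ + 1ℚ

      ∣q∣<c : ∣ q ∣ < c
      ∣q∣<c = subst (_< c) (ℚ.+-identityʳ ∣ q ∣) (ℚ.+-monoʳ-< ∣ q ∣ (ℚ.positive⁻¹ 1ℚ))

      instance
        c-positive : ℚ.Positive c
        c-positive = positive (ℚ.≤-<-trans (ℚ.0≤∣p∣ q) ∣q∣<c)

        c-nonZero : ℚ.NonZero c
        c-nonZero = ℚ.pos⇒nonZero c

      1/c : ℚ
      1/c = 1/ c

      instance
        1/c-positive : ℚ.Positive 1/c
        1/c-positive = ℚ.1/pos⇒pos c

fromℚ : ℚ → ℝ
fromℚ q = mkℝ (λ _ → q) (constant-cauchy q)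

infixl 6 _+ℝ_
_+ℝ_ : ℝ → ℝ → ℝ
x +ℝ y = mkℝ (λ k → seq x k + seq y k) (+-cauchy (seq x) (seq y) (cauchy x) (cauchy y))

infixr 7 _·_
_·_ : ℚ → ℝ → ℝ
q · x = mkℝ (λ k → q * seq x k) (·-cauchy q (seq x) (cauchy x))

open RawSemiring ℚ.+-*-rawSemiring public using () renaming (_^_ to _^ℚ_)

record FiniteDecSetoid : Set₁ where
  field
    decSetoid : DecSetoid 0ℓ 0ℓ

  open DecSetoid decSetoid public
    using (Carrier; _≈_; _≟_) renaming (setoid to underlying)

  field
    elements            : List Carrier
    elements-enumerates : IsEnumeration underlying elements
    elements-unique     : Unique underlying elements

module MarkovChain (S : FiniteDecSetoid) where
  open FiniteDecSetoid S

  ∑ : (Carrier → ℚ) → ℚ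
  ∑ f = foldr _+_ 0ℚ (map f elements)

  ∑ℝ : (Carrier → ℝ) → ℝ
  ∑ℝ f = foldr _+ℝ_ (fromℚ 0ℚ) (map f elements)

  Matrix : Set
  Matrix = Carrier → Carrier → ℚ

  identity : Matrix
  identity i j = if does (i ≟ j) then 1ℚ else 0ℚ

  infixl 7 _⊗_
  _⊗_ : Matrix → Matrix → Matrix
  (A ⊗ B) i j = ∑ λ l → A i l * B l j

  infixr 8 _^_
  _^_ : Matrix → ℕ → Matrix
  P ^ zero  = identity
  P ^ suc k = P ⊗ P ^ k

  record IsDoublyStochastic (P : Matrix) : Set where
    field
      nonNegative : ∀ i j → 0ℚ ≤ P i j
      rowSums     : ∀ i → (∑ λ j → P i j) ≡ 1ℚ
      columnSums  : ∀ j → (∑ λ i → P i j) ≡ 1ℚ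

  Irreducible : Matrix → Set
  Irreducible P = ∀ i j → ∃[ k ] (1 ℕ.≤ k × 0ℚ < (P ^ k) i j)

  -- For every state i, the gcd of the return times
  -- { k ≥ 1 : (P ^ k) i i > 0 } is 1.
  Aperiodic : Matrix → Set
  Aperiodic P =
    ∀ i d → (∀ k → 1 ℕ.≤ k → 0ℚ < (P ^ k) i i → d ∣ k) → d ≡ 1

  Ergodic : Matrix → Set
  Ergodic P = Irreducible P × Aperiodic P

  record IsProbabilityDistribution (μ : Carrier → ℝ) : Set where
    field
      μ-cong      : ∀ {i j} → i ≈ j → μ i ≃ μ j
      nonNegative : ∀ i → NonNegativeℝ (μ i)
      total       : ∑ℝ μ ≃ fromℚ 1ℚ

  -- P i j is read as the probability of passing from j to i, so that
  -- distributions are column vectors and evolve by μ ↦ P μ.  This is the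
  -- convention under which the matrix of y ↦ a y (whose j-th column is
  -- the image of j) describes the chain y ↦ g y with g drawn from a.
  record IsStationary (P : Matrix) (μ : Carrier → ℝ) : Set where
    field
      isProbabilityDistribution : IsProbabilityDistribution μ
      invariant                 : ∀ i → (∑ℝ λ j → P i j · μ j) ≃ μ i

  IsUniqueStationary : Matrix → (Carrier → ℝ) → Set
  IsUniqueStationary P ν =
    IsStationary P ν × (∀ μ → IsStationary P μ → ∀ i → μ i ≃ ν i)

module GroupAlgebra (𝔾 : Group 0ℓ 0ℓ) (_≟_ : Decidable (Group._≈_ 𝔾)) where
  open Group 𝔾 using (Carrier; ε; _∙_)

  -- Formal ℤ-linear combinations; two of them denote the same element of
  -- the group algebra when all their coefficients agree.
  ℤ[G] : Set
  ℤ[G] = List (ℤ × Carrier)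

  coeff : ℤ[G] → Carrier → ℤ
  coeff []            g = ℤ.0ℤ
  coeff ((c , h) ∷ y) g = if does (h ≟ g) then c ℤ.+ coeff y g else coeff y g

  [_] : Carrier → ℤ[G]
  [ g ] = (ℤ.1ℤ , g) ∷ []

  0# : ℤ[G]
  0# = []

  infixl 6 _⊕_
  _⊕_ : ℤ[G] → ℤ[G] → ℤ[G]
  _⊕_ = _++_

  infixl 7 _⊛_
  _⊛_ : ℤ[G] → ℤ[G] → ℤ[G]
  _⊛_ = cartesianProductWith λ { (a , g) (b , h) → a ℤ.* b , g ∙ h }

  -- Σ< N a = a 0 + a 1 + … + a (N - 1)
  Σ< : ℕ → (ℕ → ℤ[G]) → ℤ[G]
  Σ< N a = foldr _⊕_ 0# (map a (upTo N))

  power : Carrier → ℕ → Carrier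
  power g zero    = ε
  power g (suc k) = g ∙ power g k

  matrixOf : (ℤ[G] → ℤ[G]) → Carrier → Carrier → ℤ
  matrixOf f i j = coeff (f [ j ]) i

-- In the cyclic group of order m, γᵃ is encoded by the exponent a < m.
module _ (m : ℕ) .{{_ : NonZero m}} where

  private
    toℕ-mod : ∀ a → toℕ (a mod m) ≡ a % m
    toℕ-mod a = Fin.toℕ-fromℕ< (m%n<n a m)

    mod-cong : ∀ {a b} → a % m ≡ b % m → a mod m ≡ b mod m
    mod-cong {a} {b} eq =
      Fin.toℕ-injective (trans (toℕ-mod a) (trans eq (sym (toℕ-mod b))))

    mod-toℕ : ∀ (ρ : Fin m) → toℕ ρ mod m ≡ ρ
    mod-toℕ ρ = Fin.toℕ-injective (trans (toℕ-mod (toℕ ρ)) (m<n⇒m%n≡m (Fin.toℕ<n ρ)))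

    +-modˡ : ∀ a b → (a % m ℕ.+ b) % m ≡ (a ℕ.+ b) % m
    +-modˡ a b = begin
      (a % m ℕ.+ b) % m           ≡⟨ %-distribˡ-+ (a % m) b m ⟩
      (a % m % m ℕ.+ b % m) % m   ≡⟨ cong (λ r → (r ℕ.+ b % m) % m) (m%n%n≡m%n a m) ⟩
      (a % m ℕ.+ b % m) % m       ≡⟨ %-distribˡ-+ a b m ⟨
      (a ℕ.+ b) % m               ∎
      where open ≡-Reasoning

    +-modʳ : ∀ a b → (a ℕ.+ b % m) % m ≡ (a ℕ.+ b) % m
    +-modʳ a b = trans (cong (_% m) (ℕ.+-comm a (b % m)))
                       (trans (+-modˡ b a) (cong (_% m) (ℕ.+-comm b a)))

    infixl 7 _∙_
    _∙_ : Fin m → Fin m → Fin m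
    ρ ∙ σ = (toℕ ρ ℕ.+ toℕ σ) mod m

    1# : Fin m
    1# = 0 mod m

    _⁻¹ : Fin m → Fin m
    ρ ⁻¹ = (m ∸ toℕ ρ) mod m

    ∙-comm : ∀ ρ σ → ρ ∙ σ ≡ σ ∙ ρ
    ∙-comm ρ σ = cong (_mod m) (ℕ.+-comm (toℕ ρ) (toℕ σ))

    ∙-assoc : ∀ ρ σ τ → (ρ ∙ σ) ∙ τ ≡ ρ ∙ (σ ∙ τ)
    ∙-assoc ρ σ τ = mod-cong (begin
      (toℕ (ρ ∙ σ) ℕ.+ toℕ τ) % m             ≡⟨ cong (λ r → (r ℕ.+ toℕ τ) % m) (toℕ-mod _) ⟩
      ((toℕ ρ ℕ.+ toℕ σ) % m ℕ.+ toℕ τ) % m   ≡⟨ +-modˡ _ (toℕ τ) ⟩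
      (toℕ ρ ℕ.+ toℕ σ ℕ.+ toℕ τ) % m         ≡⟨ cong (_% m) (ℕ.+-assoc (toℕ ρ) _ _) ⟩
      (toℕ ρ ℕ.+ (toℕ σ ℕ.+ toℕ τ)) % m       ≡⟨ +-modʳ (toℕ ρ) _ ⟨
      (toℕ ρ ℕ.+ (toℕ σ ℕ.+ toℕ τ) % m) % m   ≡⟨ cong (λ r → (toℕ ρ ℕ.+ r) % m) (toℕ-mod _) ⟨
      (toℕ ρ ℕ.+ toℕ (σ ∙ τ)) % m             ∎)
      where open ≡-Reasoning

    ∙-identityˡ : ∀ ρ → 1# ∙ ρ ≡ ρ
    ∙-identityˡ ρ = trans
      (mod-cong (trans (cong (λ r → (r ℕ.+ toℕ ρ) % m) (toℕ-mod 0)) (+-modˡ 0 (toℕ ρ))))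
      (mod-toℕ ρ)

    ∙-inverseʳ : ∀ ρ → ρ ∙ (ρ ⁻¹) ≡ 1#
    ∙-inverseʳ ρ = mod-cong (begin
      (toℕ ρ ℕ.+ toℕ (ρ ⁻¹)) % m        ≡⟨ cong (λ r → (toℕ ρ ℕ.+ r) % m) (toℕ-mod _) ⟩
      (toℕ ρ ℕ.+ (m ∸ toℕ ρ) % m) % m   ≡⟨ +-modʳ (toℕ ρ) _ ⟩
      (toℕ ρ ℕ.+ (m ∸ toℕ ρ)) % m       ≡⟨ cong (_% m) (ℕ.m+[n∸m]≡n (ℕ.<⇒≤ (Fin.toℕ<n ρ))) ⟩
      m % m                             ≡⟨ n%n≡0 m ⟩
      0                                 ≡⟨ m<n⇒m%n≡m (ℕ.>-nonZero⁻¹ m) ⟨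
      0 % m                             ∎)
      where open ≡-Reasoning

  cyclicGroup : Group 0ℓ 0ℓ
  cyclicGroup = record
    { Carrier = Fin m
    ; _≈_     = _≡_
    ; _∙_     = _∙_
    ; ε       = 1#
    ; _⁻¹     = _⁻¹
    ; isGroup = record
      { isMonoid = record
        { isSemigroup = record
          { isMagma = record
            { isEquivalence = isEquivalence
            ; ∙-cong        = cong₂ _∙_
            }
          ; assoc = ∙-assoc
          }
        ; identity = ∙-identityˡ , λ ρ → trans (∙-comm ρ 1#) (∙-identityˡ ρ)
        }
      ; inverse = (λ ρ → trans (∙-comm (ρ ⁻¹) ρ) (∙-inverseʳ ρ)) , ∙-inverseʳ
      ; ⁻¹-cong = cong _⁻¹
      }
    }

  γ : Fin m
  γ = 1 mod m

module G[_,1,_] (m n : ℕ) .{{_ : NonZero m}} .{{_ : NonZero n}} where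

  private
    module C = Group (cyclicGroup m)
    module CP = GroupProperties (cyclicGroup m)

  E : Set
  E = Fin n × Fin m

  infixr 7 _▹_
  _▹_ : Fin m → E → E
  ρ ▹ (x , ρ′) = x , ρ C.∙ ρ′

  record Element : Set where
    constructor mkElement
    field
      perm        : E ↔ E
    open Inverse perm public using (to; from)
    field
      equivariant : ∀ x ρ → to (x , ρ) ≡ ρ ▹ to (x , C.ε)

  open Element public

  infix 4 _≈_
  _≈_ : Element → Element → Set
  π ≈ π′ = ∀ e → to π e ≡ to π′ e

  private
    to∘from : ∀ π e → to π (from π e) ≡ e
    to∘from π = Inverse.strictlyInverseˡ (perm π)

    from∘to : ∀ π e → from π (to π e) ≡ e
    from∘to π = Inverse.strictlyInverseʳ (perm π)

    ▹-assoc : ∀ ρ σ e → (ρ C.∙ σ) ▹ e ≡ ρ ▹ σ ▹ e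
    ▹-assoc ρ σ (x , τ) = cong (x ,_) (C.assoc ρ σ τ)

    to-▹ : ∀ π ρ e → to π (ρ ▹ e) ≡ ρ ▹ to π e
    to-▹ π ρ (x , σ) = begin
      to π (x , ρ C.∙ σ)         ≡⟨ equivariant π x (ρ C.∙ σ) ⟩
      (ρ C.∙ σ) ▹ to π (x , C.ε) ≡⟨ ▹-assoc ρ σ _ ⟩
      ρ ▹ σ ▹ to π (x , C.ε)     ≡⟨ cong (ρ ▹_) (equivariant π x σ) ⟨
      ρ ▹ to π (x , σ)           ∎
      where open ≡-Reasoning

    from-▹ : ∀ π ρ e → from π (ρ ▹ e) ≡ ρ ▹ from π e
    from-▹ π ρ e = begin
      from π (ρ ▹ e)               ≡⟨ cong (λ e′ → from π (ρ ▹ e′)) (to∘from π e) ⟨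
      from π (ρ ▹ to π (from π e)) ≡⟨ cong (from π) (to-▹ π ρ (from π e)) ⟨
      from π (to π (ρ ▹ from π e)) ≡⟨ from∘to π _ ⟩
      ρ ▹ from π e                 ∎
      where open ≡-Reasoning

    at-1 : ∀ x ρ → (x , ρ) ≡ ρ ▹ (x , C.ε)
    at-1 x ρ = cong (x ,_) (sym (C.identityʳ ρ))

    infixl 7 _∘ᴳ_
    _∘ᴳ_ : Element → Element → Element
    π ∘ᴳ π′ = mkElement (perm π ↔-∘ perm π′)
      λ x ρ → trans (cong (to π) (equivariant π′ x ρ)) (to-▹ π ρ (to π′ (x , C.ε)))

    idᴳ : Element
    idᴳ = mkElement (↔-id E) at-1

    infixl 8 _⁻¹ᴳ
    _⁻¹ᴳ : Element → Element
    π ⁻¹ᴳ = mkElement (↔-sym (perm π))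
      λ x ρ → trans (cong (from π) (at-1 x ρ)) (from-▹ π ρ (x , C.ε))

  group : Group 0ℓ 0ℓ
  group = record
    { Carrier = Element
    ; _≈_     = _≈_
    ; _∙_     = _∘ᴳ_
    ; ε       = idᴳ
    ; _⁻¹     = _⁻¹ᴳ
    ; isGroup = record
      { isMonoid = record
        { isSemigroup = record
          { isMagma = record
            { isEquivalence = record
              { refl  = λ _ → refl
              ; sym   = λ p e → sym (p e)
              ; trans = λ p q e → trans (p e) (q e)
              }
            ; ∙-cong = λ {π} {_} {_} {τ} p q e → trans (cong (to π) (q e)) (p (to τ e))
            }
          ; assoc = λ _ _ _ _ → refl
          }
        ; identity = (λ _ _ → refl) , (λ _ _ → refl)
        }
      ; inverse = from∘to , to∘from
      ; ⁻¹-cong = λ {π} {τ} p e → begin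
          from π e                   ≡⟨ cong (from π) (to∘from τ e) ⟨
          from π (to τ (from τ e))   ≡⟨ cong (from π) (p (from τ e)) ⟨
          from π (to π (from τ e))   ≡⟨ from∘to π _ ⟩
          from τ e                   ∎
      }
    }
    where open ≡-Reasoning

  open Group group public using (ε; _∙_; _⁻¹)

  infix 4 _≟_
  _≟_ : Decidable _≈_
  π ≟ π′ = map′ (λ p → uncurry p) (λ p x ρ → p (x , ρ))
    (Fin.all? λ x → Fin.all? λ ρ → ≡-dec Fin._≟_ Fin._≟_ (to π (x , ρ)) (to π′ (x , ρ)))

  -- ⟪ σ , c ⟫ is the element determined by (x,1) ↦ (σ x, c x).
  ⟪_,_⟫ : Permutation′ n → (Fin n → Fin m) → Element
  ⟪ σ , c ⟫ = mkElement
    (mk↔ₛ′ f g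
      (λ { (y , ρ) → cong₂ _,_ (Perm.inverseʳ σ)
             (CP.//-rightDividesˡ (c (σ ⟨$⟩ˡ y)) ρ) })
      (λ { (x , ρ) → cong₂ _,_ (Perm.inverseˡ σ)
             (trans (cong (λ z → ρ C.∙ c x C.∙ (c z) C.⁻¹) (Perm.inverseˡ σ))
                    (CP.//-rightDividesʳ (c x) ρ)) }))
    λ x ρ → cong (σ ⟨$⟩ʳ x ,_) (cong (ρ C.∙_) (sym (C.identityˡ (c x))))
    where
    f g : E → E
    f (x , ρ) = σ ⟨$⟩ʳ x , ρ C.∙ c x
    g (y , ρ) = σ ⟨$⟩ˡ y , ρ C.∙ (c (σ ⟨$⟩ˡ y)) C.⁻¹

  -- The positions 1, …, n are encoded as 0, …, n - 1 in Fin n;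
  -- the value of pos outside 1, …, n is irrelevant.
  pos : ℕ → Fin n
  pos i = (i ∸ 1) mod n

  s : ℕ → Element
  s i = ⟪ Perm.transpose (pos i) (pos (suc i)) , (λ _ → C.ε) ⟫

  t : Element
  t = ⟪ Perm.id , (λ x → if does (x Fin.≟ pos 1) then γ m else C.ε) ⟫

  -- t[ i ] is tᵢ for i = 1, …, n; the value at 0 is irrelevant.
  t[_] : ℕ → Element
  t[ zero ]        = t
  t[ suc zero ]    = t
  t[ suc (suc i) ] = s (suc i) ∙ t[ suc i ] ∙ s (suc i)

  -- cycle k = s_{n-k} s_{n-k+1} ⋯ s_{n-1}, a product of k factors (k < n)
  cycle : ℕ → Element
  cycle zero    = ε
  cycle (suc k) = s (n ∸ suc k) ∙ cycle k

  open GroupAlgebra group _≟_ public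

  Sh : ℤ[G]
  Sh = Σ< n (λ k → [ cycle k ]) ⊛ Σ< m (λ a → [ power t[ n ] a ])

  permutations : ∀ l → List (Permutation′ l)
  permutations zero    = Perm.id ∷ []
  permutations (suc l) =
    cartesianProductWith (Perm.insert Fin.zero) (allFin (suc l)) (permutations l)

  vectors : ∀ l → List (Vec (Fin m) l)
  vectors zero    = [] ∷ []
  vectors (suc l) = cartesianProductWith _∷_ (allFin m) (vectors l)

  private
    decSetoidᴳ : DecSetoid 0ℓ 0ℓ
    decSetoidᴳ = record
      { isDecEquivalence = record { isEquivalence = Group.isEquivalence group ; _≟_ = _≟_ } }

    setoidᴳ : Setoid 0ℓ 0ℓ
    setoidᴳ = Group.setoid group

    permSetoid : ℕ → Setoid 0ℓ 0ℓ
    permSetoid l = record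
      { Carrier       = Permutation′ l
      ; _≈_           = Perm._≈_
      ; isEquivalence = record
        { refl  = λ _ → refl
        ; sym   = λ p i → sym (p i)
        ; trans = λ p q i → trans (p i) (q i)
        }
      }

    insert-cong : ∀ {l} {i j : Fin (suc l)} {σ τ : Permutation′ l} →
                  i ≡ j → σ Perm.≈ τ → Perm.insert Fin.zero i σ Perm.≈ Perm.insert Fin.zero j τ
    insert-cong refl p Fin.zero    = refl
    insert-cong {i = i} {σ = σ} {τ = τ} refl p (Fin.suc k) = begin
      Perm.insert Fin.zero i σ ⟨$⟩ʳ Fin.suc k ≡⟨ Perm.insert-punchIn Fin.zero i σ k ⟩
      Fin.punchIn i (σ ⟨$⟩ʳ k)                ≡⟨ cong (Fin.punchIn i) (p k) ⟩
      Fin.punchIn i (τ ⟨$⟩ʳ k)                ≡⟨ Perm.insert-punchIn Fin.zero i τ k ⟨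
      Perm.insert Fin.zero i τ ⟨$⟩ʳ Fin.suc k ∎
      where open ≡-Reasoning

    insert-injective : ∀ {l} {i j : Fin (suc l)} {σ τ : Permutation′ l} →
                       Perm.insert Fin.zero i σ Perm.≈ Perm.insert Fin.zero j τ →
                       i ≡ j × σ Perm.≈ τ
    insert-injective {i = i} {σ = σ} {τ = τ} p with refl ← p Fin.zero =
      refl , λ k → Fin.punchIn-injective i _ _ (begin
        Fin.punchIn i (σ ⟨$⟩ʳ k)                ≡⟨ Perm.insert-punchIn Fin.zero i σ k ⟨
        Perm.insert Fin.zero i σ ⟨$⟩ʳ Fin.suc k ≡⟨ p (Fin.suc k) ⟩
        Perm.insert Fin.zero i τ ⟨$⟩ʳ Fin.suc k ≡⟨ Perm.insert-punchIn Fin.zero i τ k ⟩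
        Fin.punchIn i (τ ⟨$⟩ʳ k)                ∎)
      where open ≡-Reasoning

  permutations-enumerates : ∀ l → IsEnumeration (permSetoid l) (permutations l)
  permutations-enumerates zero    σ = here λ ()
  permutations-enumerates (suc l) σ =
    Setoid∈.∈-resp-≈ (permSetoid (suc l))
      {x = Perm.insert Fin.zero (σ ⟨$⟩ʳ Fin.zero) (Perm.remove Fin.zero σ)} {y = σ}
      (Perm.insert-remove Fin.zero σ)
      (Setoid∈.∈-cartesianProductWith⁺ (setoid _) (permSetoid l) (permSetoid (suc l))
        (λ {i} {j} {σ} {τ} → insert-cong {i = i} {j} {σ} {τ})
        (List∈.∈-allFin _)
        (permutations-enumerates l (Perm.remove Fin.zero σ)))

  permutations-unique : ∀ l → Unique (permSetoid l) (permutations l)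
  permutations-unique zero    = All.[] AllPairs.∷ AllPairs.[]
  permutations-unique (suc l) =
    Setoid!.cartesianProductWith⁺ (setoid _) (permSetoid l) (permSetoid (suc l))
      (Perm.insert Fin.zero)
      (λ {i} {j} {σ} {τ} → insert-injective {i = i} {j} {σ} {τ})
      (List!.allFin⁺ (suc l)) (permutations-unique l)

  vectors-enumerates : ∀ l → IsEnumeration (setoid (Vec (Fin m) l)) (vectors l)
  vectors-enumerates zero    []      = here refl
  vectors-enumerates (suc l) (ρ ∷ v) =
    List∈.∈-cartesianProductWith⁺ _∷_ (List∈.∈-allFin ρ) (vectors-enumerates l v)

  vectors-unique : ∀ l → Unique (setoid (Vec (Fin m) l)) (vectors l)
  vectors-unique zero    = All.[] AllPairs.∷ AllPairs.[]
  vectors-unique (suc l) =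
    List!.cartesianProductWith⁺ _∷_ ∷-injective (List!.allFin⁺ m) (vectors-unique l)

  finite : FiniteDecSetoid
  finite = record
    { decSetoid           = decSetoidᴳ
    ; elements            = cartesianProductWith element (permutations n) (vectors n)
    ; elements-enumerates = λ π →
        Setoid∈.∈-resp-≈ setoidᴳ
          {x = element (σ π) (tabulate (c π))} {y = π} (canonical π)
          (Setoid∈.∈-cartesianProductWith⁺ (permSetoid n) (setoid _) setoidᴳ
            {f = element}
            (λ {σ} {τ} {u} {v} → element-cong {σ} {τ} {u} {v})
            {a = σ π}
            (permutations-enumerates n (σ π))
            (vectors-enumerates n (tabulate (c π))))
    ; elements-unique     =
        Setoid!.cartesianProductWith⁺ (permSetoid n) (setoid _) setoidᴳ element
          (λ {σ} {τ} {u} {v} → element-injective {σ} {u} {τ} {v})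
          (permutations-unique n) (vectors-unique n)
    }
    where
    element : Permutation′ n → Vec (Fin m) n → Element
    element σ v = ⟪ σ , lookup v ⟫

    element-cong : ∀ {σ τ u v} → σ Perm.≈ τ → u ≡ v → element σ u ≈ element τ v
    element-cong p refl (x , ρ) = cong (_, _) (p x)

    lookup-injective : ∀ {l} (u v : Vec (Fin m) l) →
                       (∀ x → lookup u x ≡ lookup v x) → u ≡ v
    lookup-injective u v p =
      trans (sym (tabulate∘lookup u)) (trans (tabulate-cong p) (tabulate∘lookup v))

    element-injective : ∀ {σ u τ v} → element σ u ≈ element τ v → σ Perm.≈ τ × u ≡ v
    element-injective {u = u} {v = v} p =
      (λ x → cong proj₁ (p (x , C.ε))) ,
      lookup-injective u v λ x →
        CP.∙-cancelˡ C.ε (lookup u x) (lookup v x) (cong proj₂ (p (x , C.ε)))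

    proj₁-to : ∀ π (e : E) → proj₁ (to π (proj₁ e , C.ε)) ≡ proj₁ (to π e)
    proj₁-to π (x , ρ) = sym (cong proj₁ (equivariant π x ρ))

    σ : Element → Permutation′ n
    σ π = permutation (λ x → proj₁ (to π (x , C.ε))) (λ y → proj₁ (from π (y , C.ε)))
      (λ y → trans (proj₁-to π (from π (y , C.ε))) (cong proj₁ (to∘from π _)))
      (λ x → trans (proj₁-to (π ⁻¹) (to π (x , C.ε))) (cong proj₁ (from∘to π _)))

    c : Element → Fin n → Fin m
    c π x = proj₂ (to π (x , C.ε))

    canonical : ∀ π → element (σ π) (tabulate (c π)) ≈ π
    canonical π (x , ρ) = trans
      (cong (λ r → proj₁ (to π (x , C.ε)) , ρ C.∙ r) (lookup∘tabulate (c π) x))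
      (sym (equivariant π x ρ))

  open MarkovChain finite public

  P : Matrix
  P i j = matrixOf (λ y → Sh ⊛ y) i j ℚ./ (m ℕ.* n)
    where instance _ = ℕ.m*n≢0 m n

  1/∣G∣ : ℚ
  1/∣G∣ = + 1 ℚ./ (m ℕ.^ n ℕ.* n !)
    where instance
      _ = ℕ.m^n≢0 m n
      _ = n ℕ.!≢0
      _ = ℕ.m*n≢0 (m ℕ.^ n) (n !)

  uniform : Element → ℝ
  uniform _ = fromℚ 1/∣G∣

  ConvergesAtRate : ℚ → ℚ → Set
  ConvergesAtRate α r =
    ∀ k → 1 ℕ.≤ k → ∀ i j → ∣ (P ^ k) i j - 1/∣G∣ ∣ ≤ α * r ^ℚ k

{-# OPTIONS --safe #-}
module Submission where

-- Inverting a shuffle takes a random card, rotates it at random and puts it at the last position.  So after k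
-- inverse shuffles the cards not yet touched are unrotated and in their original relative order, while the
-- arrangement of the touched ones is uniform.  With χ u the indicator of the set of elements that keep the
-- cards 1, …, u unrotated and in increasing order, this becomes the identity
--   Σ_h χ (u + 1) (h⁻¹ f) = m (n - u - 1) χ (u + 1) f + χ u f     (h over the m n shuffles).
-- For the uniform density φ u on that set, P acts by
--   φ (u + 1) ↦ ((n - u - 1) φ (u + 1) + (u + 1) φ u) / n,
-- with φ n the unit mass at 1 and φ 0 the uniform distribution.  The weight u is an eigenfunction of this
-- pure-death chain, with eigenvalue (n - 1) / n; so is u (u - 1), with eigenvalue (n - 2) / n, and for m = 1 it
-- bounds the distance of φ u to φ 0 because then φ 1 = φ 0.  As φ 0 has positive weight in every power P ^ k
-- with k ≥ n, the chain is ergodic.  If μ is stationary, φ (n - 1) * μ = P μ = μ, and the recurrence gives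
-- φ u * μ = μ successively for u = n - 2, …, 0, the last one being uniform.

open import Defs
open import Data.Nat.Base as ℕ using (ℕ; zero; suc; NonZero; _!)
open import Data.Integer.Base as ℤ using (ℤ; +_)
open import Data.Product.Base using (∃-syntax; _×_; _,_; proj₁; proj₂)
open import Data.Rational.Base as ℚ
  using (ℚ; 0ℚ; 1ℚ; ½; _/_; _+_; _-_; _*_; -_; _≤_; _<_; ∣_∣; toℚᵘ; 1/_)
open import Relation.Binary.PropositionalEquality
  using (_≡_; _≢_; refl; sym; trans; cong; cong₂; subst; subst₂)

open import Algebra.Bundles using (Group)
import Algebra.Properties.Group as GroupProperties
open import Data.Bool.Base using (if_then_else_)
open import Data.Fin.Base as Fin using (Fin; toℕ)
open import Data.Fin.Permutation as Perm
  using (Permutation′; permutation; _⟨$⟩ʳ_; _∘ₚ_)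
import Data.Fin.Properties as Fin
import Data.Integer.Properties as ℤ
open import Data.List.Base as List
  using (List; []; _∷_; _++_; foldr; map; applyUpTo; upTo; allFin; length; cartesianProductWith)
import Data.List.Properties as List
open import Data.List.Relation.Unary.All using (All; []; _∷_)
open import Data.List.Relation.Unary.All.Properties using (All¬⇒¬Any)
open import Data.List.Relation.Unary.AllPairs using (_∷_)
open import Data.List.Relation.Unary.Any as Any using (here; there)
open import Data.Nat.Divisibility using (∣m+n∣m⇒∣n; ∣1⇒≡1)
open import Data.Nat.DivMod using (_%_; _mod_; m%n<n; m<n⇒m%n≡m; %-distribˡ-+)
import Data.Nat.Properties as ℕ
import Data.Rational.Properties as ℚ
open import Data.Rational.Solver using (module +-*-Solver)
open import Data.Rational.Unnormalised.Base as ℚᵘ using (mkℚᵘ; *≡*)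
import Data.Rational.Unnormalised.Properties as ℚᵘ
open import Data.Sum.Base using (inj₁; inj₂)
open import Function.Base using (_∘_; id)
open import Function.Bundles using (_⇔_; Equivalence; mk⇔; Inverse; Injection)
open import Function.Properties.Inverse using (↔⇒↣)
open import Level using (0ℓ)
open import Relation.Binary.Bundles using (DecSetoid)
open import Relation.Binary.Definitions using (Decidable; tri<; tri≈; tri>)
open import Relation.Nullary.Decidable
  using (Dec; does; yes; no; does-⇔; _×-dec_; _→-dec_)
open import Relation.Nullary.Negation using (¬_; contradiction)

open import Algebra.Properties.CommutativeMonoid.Sum ℚ.+-0-commutativeMonoid
  using (sum; sum-cong-≗; sum-permute)
open +-*-Solver using (solve; _:+_; _:*_; _:-_; :-_; _:=_; con)

-- Rational arithmetic with integers and reciprocals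

+-congˡ : ∀ p {q r} → q ≡ r → p + q ≡ p + r
+-congˡ p = cong₂ _+_ (refl {x = p})

/-toℚᵘ : ∀ z d .{{_ : NonZero d}} → toℚᵘ (z / d) ℚᵘ.≃ (z ℚᵘ./ d)
/-toℚᵘ z (suc d) = ℚ.toℚᵘ-fromℚᵘ (mkℚᵘ z d)

-- Unnormalised fractions multiply componentwise by definition, so comparing the two sides in `ℚᵘ`
-- avoids every gcd.
/-*-homo : ∀ a b c d .{{_ : NonZero c}} .{{_ : NonZero d}} .{{_ : NonZero (c ℕ.* d)}} →
           (a ℤ.* b) / (c ℕ.* d) ≡ a / c * (b / d)
/-*-homo a b (suc c) (suc d) = ℚ.toℚᵘ-injective
  (ℚᵘ.≃-trans (/-toℚᵘ (a ℤ.* b) (suc c ℕ.* suc d))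
  (ℚᵘ.≃-sym (ℚᵘ.≃-trans (ℚ.toℚᵘ-homo-* (a / suc c) (b / suc d))
    (ℚᵘ.*-cong (/-toℚᵘ a (suc c)) (/-toℚᵘ b (suc d))))))

-- ιℤ and ι⁻¹ are abstract so that the gcd computations inside _/_ never unfold.
abstract
  ιℤ : ℤ → ℚ
  ιℤ z = z / 1

  ι⁻¹ : ∀ d .{{_ : NonZero d}} → ℚ
  ι⁻¹ d = + 1 / d

ι : ℕ → ℚ
ι k = ιℤ (+ k)

abstract
  ι-0 : ι 0 ≡ 0ℚ
  ι-0 = refl

  ι-1 : ι 1 ≡ 1ℚ
  ι-1 = refl

  1/-ι⁻¹ : ∀ d .{{_ : NonZero d}} → + 1 / d ≡ ι⁻¹ d
  1/-ι⁻¹ d = refl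

  /-ι⁻¹ : ∀ z d .{{_ : NonZero d}} → z / d ≡ ι⁻¹ d * ιℤ z
  /-ι⁻¹ z (suc d) = trans
    (ℚ./-cong (sym (ℤ.*-identityˡ z)) (sym (ℕ.*-identityʳ (suc d))))
    (/-*-homo (+ 1) z (suc d) 1)

  ιℤ-+ : ∀ a b → ιℤ (a ℤ.+ b) ≡ ιℤ a + ιℤ b
  ιℤ-+ a b = ℚ.toℚᵘ-injective
    (ℚᵘ.≃-trans (/-toℚᵘ (a ℤ.+ b) 1)
    (ℚᵘ.≃-trans (*≡* (cong (ℤ._* + 1) (sym (cong₂ ℤ._+_ (ℤ.*-identityʳ a) (ℤ.*-identityʳ b)))))
    (ℚᵘ.≃-sym (ℚᵘ.≃-trans (ℚ.toℚᵘ-homo-+ (a / 1) (b / 1))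
      (ℚᵘ.+-cong (/-toℚᵘ a 1) (/-toℚᵘ b 1))))))

  ι-* : ∀ a b → ι (a ℕ.* b) ≡ ι a * ι b
  ι-* a b = trans (cong ιℤ (ℤ.pos-* a b)) (/-*-homo (+ a) (+ b) 1 1)

  ι⁻¹-* : ∀ a b .{{_ : NonZero a}} .{{_ : NonZero b}} .{{_ : NonZero (a ℕ.* b)}} →
          ι⁻¹ (a ℕ.* b) ≡ ι⁻¹ a * ι⁻¹ b
  ι⁻¹-* = /-*-homo (+ 1) (+ 1)

  ι⁻¹-inverse : ∀ d .{{_ : NonZero d}} → ι⁻¹ d * ι d ≡ 1ℚ
  ι⁻¹-inverse (suc d) = trans (sym (/-ι⁻¹ (+ suc d) (suc d))) (ℚ.toℚᵘ-injective
    (ℚᵘ.≃-trans (/-toℚᵘ (+ suc d) (suc d)) (*≡* (ℤ.*-comm (+ suc d) (+ 1)))))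

  0≤ι : ∀ k → 0ℚ ≤ ι k
  0≤ι k = ℚ.nonNegative⁻¹ (ι k) {{ℚ.normalize-nonNeg k 1}}

  0<ι : ∀ k .{{_ : NonZero k}} → 0ℚ < ι k
  0<ι k = ℚ.positive⁻¹ (ι k) {{ℚ.normalize-pos k 1}}

  0<ι⁻¹ : ∀ d .{{_ : NonZero d}} → 0ℚ < ι⁻¹ d
  0<ι⁻¹ d = ℚ.positive⁻¹ (ι⁻¹ d) {{ℚ.normalize-pos 1 d}}

ι-+ : ∀ a b → ι (a ℕ.+ b) ≡ ι a + ι b
ι-+ a b = ιℤ-+ (+ a) (+ b)

ι-suc : ∀ k → ι (suc k) ≡ 1ℚ + ι k
ι-suc k = trans (ι-+ 1 k) (cong (_+ ι k) ι-1)

p≤p+q : ∀ p {q} → 0ℚ ≤ q → p ≤ p + q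
p≤p+q p {q} 0≤q = subst (_≤ p + q) (ℚ.+-identityʳ p) (ℚ.+-monoʳ-≤ p 0≤q)

ι-mono : ∀ {a b} → a ℕ.≤ b → ι a ≤ ι b
ι-mono {a} {b} a≤b = subst (ι a ≤_) (trans (sym (ι-+ a (b ℕ.∸ a))) (cong ι (ℕ.m+[n∸m]≡n a≤b)))
  (p≤p+q (ι a) (0≤ι (b ℕ.∸ a)))

ι⁻¹-cancel : ∀ d .{{_ : NonZero d}} q → ι⁻¹ d * (ι d * q) ≡ q
ι⁻¹-cancel d q = trans (sym (ℚ.*-assoc (ι⁻¹ d) (ι d) q))
  (trans (cong (_* q) (ι⁻¹-inverse d)) (ℚ.*-identityˡ q))

0≤p*q : ∀ {p q} → 0ℚ ≤ p → 0ℚ ≤ q → 0ℚ ≤ p * q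
0≤p*q {p} {q} 0≤p 0≤q = subst (_≤ p * q) (ℚ.*-zeroʳ p)
  (ℚ.*-monoˡ-≤-nonNeg p {{ℚ.nonNegative 0≤p}} 0≤q)

0<p*q : ∀ {p q} → 0ℚ < p → 0ℚ < q → 0ℚ < p * q
0<p*q {p} {q} 0<p 0<q = subst (_< p * q) (ℚ.*-zeroʳ p)
  (ℚ.*-monoʳ-<-pos p {{ℚ.positive 0<p}} 0<q)

*-monoˡ-≤ : ∀ {p q r} → 0ℚ ≤ p → q ≤ r → p * q ≤ p * r
*-monoˡ-≤ {p} 0≤p = ℚ.*-monoˡ-≤-nonNeg p {{ℚ.nonNegative 0≤p}}

-- Sums over lists

sumOver : ∀ {A : Set} → List A → (A → ℚ) → ℚ
sumOver xs f = foldr _+_ 0ℚ (map f xs)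

module _ {A : Set} where

  sumOver-cong : ∀ {f g : A → ℚ} (xs : List A) → (∀ x → f x ≡ g x) → sumOver xs f ≡ sumOver xs g
  sumOver-cong []       f≗g = refl
  sumOver-cong (x ∷ xs) f≗g = cong₂ _+_ (f≗g x) (sumOver-cong xs f≗g)

  sumOver-+ : ∀ (xs : List A) (f g : A → ℚ) →
              sumOver xs (λ x → f x + g x) ≡ sumOver xs f + sumOver xs g
  sumOver-+ []       f g = refl
  sumOver-+ (x ∷ xs) f g = trans (+-congˡ (f x + g x) (sumOver-+ xs f g))
    (interchange (f x) (g x) (sumOver xs f) (sumOver xs g))
    where
    interchange : ∀ a b c d → a + b + (c + d) ≡ a + c + (b + d)
    interchange = solve 4 (λ a b c d → a :+ b :+ (c :+ d) := a :+ c :+ (b :+ d)) refl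

  sumOver-* : ∀ (xs : List A) q (f : A → ℚ) → sumOver xs (λ x → q * f x) ≡ q * sumOver xs f
  sumOver-* []       q f = sym (ℚ.*-zeroʳ q)
  sumOver-* (x ∷ xs) q f = trans (+-congˡ (q * f x) (sumOver-* xs q f))
    (sym (ℚ.*-distribˡ-+ q (f x) (sumOver xs f)))

  sumOver-0 : ∀ (xs : List A) → sumOver xs (λ _ → 0ℚ) ≡ 0ℚ
  sumOver-0 []       = refl
  sumOver-0 (x ∷ xs) = +-congˡ 0ℚ (sumOver-0 xs)

  sumOver-const : ∀ (xs : List A) q → sumOver xs (λ _ → q) ≡ ι (List.length xs) * q
  sumOver-const []       q = sym (trans (cong (_* q) ι-0) (ℚ.*-zeroˡ q))
  sumOver-const (x ∷ xs) q = trans (+-congˡ q (sumOver-const xs q))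
    (trans (factor q (ι (List.length xs))) (cong (_* q) (sym (ι-suc (List.length xs)))))
    where
    factor : ∀ q l → q + l * q ≡ (1ℚ + l) * q
    factor = solve 2 (λ q l → q :+ l :* q := (con 1ℚ :+ l) :* q) refl

  sumOver-≥0 : ∀ (xs : List A) {f : A → ℚ} → (∀ x → 0ℚ ≤ f x) → 0ℚ ≤ sumOver xs f
  sumOver-≥0 []       0≤f = ℚ.≤-refl
  sumOver-≥0 (x ∷ xs) 0≤f = ℚ.+-mono-≤ (0≤f x) (sumOver-≥0 xs 0≤f)

  sumOver-++ : ∀ (xs ys : List A) (f : A → ℚ) → sumOver (xs ++ ys) f ≡ sumOver xs f + sumOver ys f
  sumOver-++ []       ys f = sym (ℚ.+-identityˡ _)
  sumOver-++ (x ∷ xs) ys f = trans (+-congˡ (f x) (sumOver-++ xs ys f))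
    (sym (ℚ.+-assoc (f x) _ _))

  sumOver-map : ∀ {B : Set} (g : B → A) (xs : List B) (f : A → ℚ) →
                sumOver (map g xs) f ≡ sumOver xs (f ∘ g)
  sumOver-map g []       f = refl
  sumOver-map g (x ∷ xs) f = +-congˡ (f (g x)) (sumOver-map g xs f)

sumOver-swap : ∀ {A B : Set} (xs : List A) (ys : List B) (f : A → B → ℚ) →
  sumOver xs (λ x → sumOver ys (f x)) ≡ sumOver ys (λ y → sumOver xs (λ x → f x y))
sumOver-swap []       ys f = sym (sumOver-0 ys)
sumOver-swap (x ∷ xs) ys f = trans (+-congˡ (sumOver ys (f x)) (sumOver-swap xs ys f))
  (sym (sumOver-+ ys (f x) _))

sumOver-cartesianProductWith : ∀ {A B C : Set} (_∙_ : A → B → C) xs ys (f : C → ℚ) →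
  sumOver (cartesianProductWith _∙_ xs ys) f ≡ sumOver xs (λ x → sumOver ys (λ y → f (x ∙ y)))
sumOver-cartesianProductWith _∙_ []       ys f = refl
sumOver-cartesianProductWith _∙_ (x ∷ xs) ys f = trans
  (sumOver-++ (map (x ∙_) ys) (cartesianProductWith _∙_ xs ys) f)
  (cong₂ _+_ (sumOver-map (x ∙_) ys f) (sumOver-cartesianProductWith _∙_ xs ys f))

sumOver-applyUpTo : ∀ (g : ℕ → ℕ) (f : ℕ → ℚ) k →
                    sumOver (applyUpTo g k) f ≡ sum {k} (λ i → f (g (toℕ i)))
sumOver-applyUpTo g f zero    = refl
sumOver-applyUpTo g f (suc k) = +-congˡ (f (g 0)) (sumOver-applyUpTo (g ∘ suc) f k)

sumOver-upTo : ∀ (f : ℕ → ℚ) k → sumOver (upTo k) f ≡ sum {k} (λ i → f (toℕ i))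
sumOver-upTo = sumOver-applyUpTo id

sum-const : ∀ k q → sum {k} (λ _ → q) ≡ ι k * q
sum-const zero    q = sym (trans (cong (_* q) ι-0) (ℚ.*-zeroˡ q))
sum-const (suc k) q = trans (+-congˡ q (sum-const k q))
  (trans (solve 2 (λ q l → q :+ l :* q := (con 1ℚ :+ l) :* q) refl q (ι k)) (cong (_* q) (sym (ι-suc k))))

-- The shape of both sums in `χ-step`: over the cards, those before the top one contribute nothing,
-- the top one `a` and each later one `b`; over the rotations of the top card, `b` is 0.
sum-step : ∀ {k} (u : Fin k) (f : Fin k → ℚ) {a b} →
           (∀ i → toℕ i ℕ.< toℕ u → f i ≡ 0ℚ) → f u ≡ a → (∀ i → toℕ u ℕ.< toℕ i → f i ≡ b) →
           sum f ≡ a + ι (k ℕ.∸ suc (toℕ u)) * b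
sum-step {suc k} Fin.zero f lt eq gt =
  cong₂ _+_ eq (trans (sum-cong-≗ (λ i → gt (Fin.suc i) (ℕ.s≤s ℕ.z≤n))) (sum-const k _))
sum-step {suc k} (Fin.suc u) f lt eq gt =
  trans (cong (_+ sum (f ∘ Fin.suc)) (lt Fin.zero (ℕ.s≤s ℕ.z≤n)))
    (trans (ℚ.+-identityˡ _)
      (sum-step u (f ∘ Fin.suc) (λ i i<u → lt (Fin.suc i) (ℕ.s≤s i<u)) eq
        (λ i u<i → gt (Fin.suc i) (ℕ.s≤s u<i))))

-- Indicators

𝟙 : ∀ {P : Set} → Dec P → ℚ
𝟙 P? = if does P? then 1ℚ else 0ℚ

𝟙-⇔ : ∀ {P Q : Set} → P ⇔ Q → (P? : Dec P) (Q? : Dec Q) → 𝟙 P? ≡ 𝟙 Q?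
𝟙-⇔ P⇔Q P? Q? = cong (λ b → if b then 1ℚ else 0ℚ) (does-⇔ P⇔Q P? Q?)

𝟙-true : ∀ {P : Set} (P? : Dec P) → P → 𝟙 P? ≡ 1ℚ
𝟙-true (yes _) p = refl
𝟙-true (no ¬p) p = contradiction p ¬p

𝟙-false : ∀ {P : Set} (P? : Dec P) → ¬ P → 𝟙 P? ≡ 0ℚ
𝟙-false (yes p) ¬p = contradiction p ¬p
𝟙-false (no _)  ¬p = refl

0≤𝟙 : ∀ {P : Set} (P? : Dec P) → 0ℚ ≤ 𝟙 P?
0≤𝟙 (yes _) = ℚ.nonNegative⁻¹ 1ℚ
0≤𝟙 (no _)  = ℚ.≤-refl

𝟙≤1 : ∀ {P : Set} (P? : Dec P) → 𝟙 P? ≤ 1ℚ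
𝟙≤1 (yes _) = ℚ.≤-refl
𝟙≤1 (no _)  = ℚ.nonNegative⁻¹ 1ℚ

module _ (S : FiniteDecSetoid) where
  open FiniteDecSetoid S
  open DecSetoid decSetoid using () renaming (sym to ≈-sym; trans to ≈-trans)
  open import Data.List.Membership.Setoid underlying using (_∈_)
  open import Data.List.Relation.Unary.Unique.Setoid underlying using (Unique)

  -- The enumeration meets each class exactly once, so a single term survives. Its entry is only
  -- equivalent to `g`, whence the condition on `f`.
  sum-𝟙 : (g : Carrier) (f : Carrier → ℚ) → (∀ {x y} → x ≈ y → f x ≡ f y) →
          sumOver elements (λ x → 𝟙 (g ≟ x) * f x) ≡ f g
  sum-𝟙 g f f-cong = go elements elements-unique (elements-enumerates g)
    where
    absent : ∀ xs {y} → g ≈ y → All (λ x → ¬ y ≈ x) xs → sumOver xs (λ x → 𝟙 (g ≟ x) * f x) ≡ 0ℚ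
    absent []       g≈y []             = refl
    absent (x ∷ xs) g≈y (y≉x ∷ y∉xs) = cong₂ _+_
      (trans (cong (_* f x) (𝟙-false (g ≟ x) (λ g≈x → y≉x (≈-trans (≈-sym g≈y) g≈x)))) (ℚ.*-zeroˡ (f x)))
      (absent xs g≈y y∉xs)

    go : ∀ xs → Unique xs → g ∈ xs → sumOver xs (λ x → 𝟙 (g ≟ x) * f x) ≡ f g
    go (x ∷ xs) (x∉xs ∷ _) (here g≈x) = trans (cong₂ _+_
      (trans (cong (_* f x) (𝟙-true (g ≟ x) g≈x)) (trans (ℚ.*-identityˡ (f x)) (f-cong (≈-sym g≈x))))
      (absent xs g≈x x∉xs)) (ℚ.+-identityʳ (f g))
    go (x ∷ xs) (x∉xs ∷ xs!) (there g∈xs) = trans (cong₂ _+_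
      (trans (cong (_* f x) (𝟙-false (g ≟ x) g≉x)) (ℚ.*-zeroˡ (f x)))
      (go xs xs! g∈xs)) (ℚ.+-identityˡ (f g))
      where
      g≉x : ¬ g ≈ x
      g≉x g≈x = All¬⇒¬Any x∉xs (Any.map (≈-trans (≈-sym g≈x)) g∈xs)

-- Residues, adjacent transpositions and monotone maps

toℕ-mod : ∀ a d .{{_ : NonZero d}} → a ℕ.< d → toℕ (a mod d) ≡ a
toℕ-mod a d a<d = trans (Fin.toℕ-fromℕ< (m%n<n a d)) (m<n⇒m%n≡m a<d)

mod-toℕ : ∀ {d} .{{_ : NonZero d}} (i : Fin d) → toℕ i mod d ≡ i
mod-toℕ {d} i = Fin.toℕ-injective (toℕ-mod (toℕ i) d (Fin.toℕ<n i))

module _ {n} (i j : Fin n) where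

  transposeˡ : Perm.transpose i j ⟨$⟩ʳ i ≡ j
  transposeˡ with i Fin.≟ i
  ... | yes _  = refl
  ... | no i≢i = contradiction refl i≢i

  transposeʳ : Perm.transpose i j ⟨$⟩ʳ j ≡ i
  transposeʳ with j Fin.≟ i
  ... | yes j≡i = j≡i
  ... | no _ with j Fin.≟ j
  ...   | yes _  = refl
  ...   | no j≢j = contradiction refl j≢j

  transpose-fixes : ∀ {k} → k ≢ i → k ≢ j → Perm.transpose i j ⟨$⟩ʳ k ≡ k
  transpose-fixes {k} k≢i k≢j with k Fin.≟ i
  ... | yes k≡i = contradiction k≡i k≢i
  ... | no _ with k Fin.≟ j
  ...   | yes k≡j = contradiction k≡j k≢j
  ...   | no _    = refl

  transpose-onto : ∀ {k} → Perm.transpose i j ⟨$⟩ʳ k ≡ i → k ≡ j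
  transpose-onto eq = Injection.injective (↔⇒↣ (Perm.transpose i j)) (trans eq (sym transposeʳ))

-- As `p` follows `i` immediately, these are the only two points whose order the transposition
-- reverses, and `p` is excluded.
transpose-mono : ∀ {n} (i p : Fin n) → toℕ p ≡ suc (toℕ i) → ∀ {x y} → x ≢ p → y ≢ p → x Fin.< y →
  Perm.transpose i p ⟨$⟩ʳ x Fin.< Perm.transpose i p ⟨$⟩ʳ y
transpose-mono i p p≡1+i {x} {y} x≢p y≢p x<y = by-cases (x Fin.≟ i) (y Fin.≟ i)
  where
  by-cases : Dec (x ≡ i) → Dec (y ≡ i) →
             Perm.transpose i p ⟨$⟩ʳ x Fin.< Perm.transpose i p ⟨$⟩ʳ y
  by-cases (yes x≡i) (yes y≡i)   = contradiction (trans x≡i (sym y≡i)) (Fin.<⇒≢ x<y)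
  by-cases (yes refl) (no y≢i)   = subst₂ Fin._<_ (sym (transposeˡ i p)) (sym (transpose-fixes i p y≢i y≢p))
    (ℕ.≤∧≢⇒< (subst (ℕ._≤ toℕ y) (sym p≡1+i) x<y) (y≢p ∘ sym ∘ Fin.toℕ-injective))
  by-cases (no x≢i) (yes refl)   = subst₂ Fin._<_ (sym (transpose-fixes i p x≢i x≢p)) (sym (transposeˡ i p))
    (ℕ.<-trans x<y (ℕ.≤-reflexive (sym p≡1+i)))
  by-cases (no x≢i) (no y≢i)     = subst₂ Fin._<_ (sym (transpose-fixes i p x≢i x≢p))
    (sym (transpose-fixes i p y≢i y≢p)) x<y

-- By induction on the value of `x`: the image of `x` exceeds that of the preceding point.
monotone⇒inflationary : ∀ {n} (q : Fin n → Fin n) → (∀ {x y} → x Fin.< y → q x Fin.< q y) →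
                        ∀ x → x Fin.≤ q x
monotone⇒inflationary {n} q q-mono x = go (toℕ x) x refl
  where
  go : ∀ k x → toℕ x ≡ k → k ℕ.≤ toℕ (q x)
  go zero    x _       = ℕ.z≤n
  go (suc k) x x≡1+k = ℕ.≤-<-trans (go k y y≡k) (q-mono (subst (ℕ._< toℕ x) (sym y≡k) k<x))
    where
    k<x : k ℕ.< toℕ x
    k<x = ℕ.≤-reflexive (sym x≡1+k)
    k<n : k ℕ.< n
    k<n = ℕ.<-trans k<x (Fin.toℕ<n x)
    y : Fin n
    y = Fin.fromℕ< k<n
    y≡k : toℕ y ≡ k
    y≡k = Fin.toℕ-fromℕ< k<n

mod-suc : ∀ a m .{{_ : NonZero m}} → Group._∙_ (cyclicGroup m) (a mod m) (γ m) ≡ suc a mod m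
mod-suc a m = Fin.toℕ-injective (trans (toℕ-% (toℕ (a mod m) ℕ.+ toℕ (1 mod m)))
  (trans (cong₂ (λ b c → (b ℕ.+ c) % m) (toℕ-% a) (toℕ-% 1))
  (trans (sym (%-distribˡ-+ a 1 m))
  (trans (cong (_% m) (ℕ.+-comm a 1)) (sym (toℕ-% (suc a)))))))
  where
  toℕ-% : ∀ b → toℕ (b mod m) ≡ b % m
  toℕ-% b = Fin.toℕ-fromℕ< (m%n<n b m)

-- Shuffles as insertions of the last card

module Shuffles (m n : ℕ) .{{_ : NonZero m}} .{{_ : NonZero n}} where
  open G[_,1,_] m n
  module C = Group (cyclicGroup m)
  module CP = GroupProperties (cyclicGroup m)

  last : Fin n
  last = pos n

  toℕ-pos : ∀ {i} → suc i ℕ.≤ n → toℕ (pos (suc i)) ≡ i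
  toℕ-pos {i} 1+i≤n = toℕ-mod i n 1+i≤n

  suc-pred-n : suc (ℕ.pred n) ≡ n
  suc-pred-n = ℕ.suc-pred n

  pos-suc-toℕ : ∀ x → pos (suc (toℕ x)) ≡ x
  pos-suc-toℕ x = mod-toℕ x

  toℕ-last : suc (toℕ last) ≡ n
  toℕ-last = trans (cong suc (toℕ-mod (n ℕ.∸ 1) n (ℕ.≤-reflexive eq))) eq
    where
    eq : suc (n ℕ.∸ 1) ≡ n
    eq = trans (cong suc (sym (ℕ.pred[m∸n]≡m∸[1+n] n 0))) (ℕ.suc-pred n)

  ≤-last : ∀ x → x Fin.≤ last
  ≤-last x = ℕ.≤-pred (subst (toℕ x ℕ.<_) (sym toℕ-last) (Fin.toℕ<n x))

  <-last : ∀ {x} → x ≢ last → x Fin.< last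
  <-last {x} x≢last = ℕ.≤∧≢⇒< (≤-last x) (x≢last ∘ Fin.toℕ-injective)

  pos-suc-≢ : ∀ {i} → suc (suc i) ℕ.≤ n → pos (suc (suc i)) ≢ pos (suc i)
  pos-suc-≢ {i} 2+i≤n eq =
    ℕ.1+n≢n (trans (sym (toℕ-pos 2+i≤n)) (trans (cong toℕ eq) (toℕ-pos (ℕ.<⇒≤ 2+i≤n))))

  s-left : ∀ i ρ → to (s i) (pos i , ρ) ≡ (pos (suc i) , ρ)
  s-left i ρ = cong₂ _,_ (transposeˡ (pos i) (pos (suc i))) (C.identityʳ ρ)

  s-right : ∀ i ρ → to (s i) (pos (suc i) , ρ) ≡ (pos i , ρ)
  s-right i ρ = cong₂ _,_ (transposeʳ (pos i) (pos (suc i))) (C.identityʳ ρ)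

  s-fixes : ∀ i {x} ρ → x ≢ pos i → x ≢ pos (suc i) → to (s i) (x , ρ) ≡ (x , ρ)
  s-fixes i ρ x≢i x≢1+i = cong₂ _,_ (transpose-fixes (pos i) (pos (suc i)) x≢i x≢1+i) (C.identityʳ ρ)

  -- Conjugation by `s (suc i)` moves the position at which `t[ suc i ]` rotates up by one.
  t-at : ∀ i ρ → to t[ suc i ] (pos (suc i) , ρ) ≡ (pos (suc i) , ρ C.∙ γ m)
  t-at zero ρ with pos 1 Fin.≟ pos 1
  ... | yes _  = refl
  ... | no 1≢1 = contradiction refl 1≢1
  t-at (suc i) ρ = trans (cong (to (s (suc i)) ∘ to t[ suc i ]) (s-right (suc i) ρ))
    (trans (cong (to (s (suc i))) (t-at i ρ)) (s-left (suc i) _))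

  t-fixes : ∀ i {x} ρ → suc i ℕ.≤ n → x ≢ pos (suc i) → to t[ suc i ] (x , ρ) ≡ (x , ρ)
  t-fixes zero {x} ρ _ x≢1 with x Fin.≟ pos 1
  ... | yes x≡1 = contradiction x≡1 x≢1
  ... | no _    = cong (x ,_) (C.identityʳ ρ)
  t-fixes (suc i) {x} ρ 2+i≤n x≢2+i = by-cases (x Fin.≟ pos (suc i))
    where
    by-cases : Dec (x ≡ pos (suc i)) → to t[ suc (suc i) ] (x , ρ) ≡ (x , ρ)
    -- The bound `2+i≤n` prevents `pos` from wrapping modulo `n`, so the image of this point under
    -- `s (suc i)` is one that `t[ suc i ]` fixes.
    by-cases (yes refl) = trans (cong (to (s (suc i)) ∘ to t[ suc i ]) (s-left (suc i) ρ))
      (trans (cong (to (s (suc i))) (t-fixes i ρ (ℕ.<⇒≤ 2+i≤n) (pos-suc-≢ 2+i≤n))) (s-right (suc i) ρ))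
    by-cases (no x≢1+i) = trans (cong (to (s (suc i)) ∘ to t[ suc i ]) (s-fixes (suc i) ρ x≢1+i x≢2+i))
      (trans (cong (to (s (suc i))) (t-fixes i ρ (ℕ.<⇒≤ 2+i≤n) x≢1+i)) (s-fixes (suc i) ρ x≢1+i x≢2+i))

  -- All that is used later about the action of a single shuffle. Here `f` is a bare map, so that
  -- the factors of a shuffle can be composed one at a time.
  record Inserts (p : Fin n) (c : Fin m) (f : E → E) : Set where
    field
      at-last   : ∀ ρ → f (last , ρ) ≡ (p , ρ C.∙ c)
      unrotated : ∀ x ρ → x ≢ last → f (x , ρ) ≡ (proj₁ (f (x , C.ε)) , ρ)
      monotone  : ∀ {x y} → x Fin.< y → y Fin.< last → proj₁ (f (x , C.ε)) Fin.< proj₁ (f (y , C.ε))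
      avoids    : ∀ {x} → x ≢ last → proj₁ (f (x , C.ε)) ≢ p

  t[n]-at : ∀ ρ → to t[ n ] (last , ρ) ≡ (last , ρ C.∙ γ m)
  -- `t-at` speaks of successors only, hence the detour through `suc (ℕ.pred n)`.
  t[n]-at ρ = subst (λ k → to t[ k ] (pos k , ρ) ≡ (pos k , ρ C.∙ γ m)) suc-pred-n (t-at (ℕ.pred n) ρ)

  t[n]-fixes : ∀ {x} ρ → x ≢ last → to t[ n ] (x , ρ) ≡ (x , ρ)
  t[n]-fixes {x} ρ = subst (λ k → x ≢ pos k → to t[ k ] (x , ρ) ≡ (x , ρ)) suc-pred-n
    (t-fixes (ℕ.pred n) ρ (ℕ.≤-reflexive suc-pred-n))

  power-at : ∀ a ρ → to (power t[ n ] a) (last , ρ) ≡ (last , ρ C.∙ (a mod m))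
  power-at zero    ρ = cong (last ,_) (sym (C.identityʳ ρ))
  power-at (suc a) ρ = trans (cong (to t[ n ]) (power-at a ρ))
    (trans (t[n]-at _) (cong (last ,_) (trans (C.assoc ρ (a mod m) (γ m)) (cong (ρ C.∙_) (mod-suc a m)))))

  power-fixes : ∀ a {x} ρ → x ≢ last → to (power t[ n ] a) (x , ρ) ≡ (x , ρ)
  power-fixes zero    ρ x≢last = refl
  power-fixes (suc a) ρ x≢last = trans (cong (to t[ n ]) (power-fixes a ρ x≢last)) (t[n]-fixes ρ x≢last)

  power-inserts : ∀ a → Inserts last (a mod m) (to (power t[ n ] a))
  power-inserts a = record
    { at-last   = power-at a
    ; unrotated = λ x ρ x≢last → trans (power-fixes a ρ x≢last)
        (cong (_, ρ) (sym (cong proj₁ (power-fixes a C.ε x≢last))))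
    ; monotone  = λ {x} {y} x<y y<last →
        let y≢last = Fin.<⇒≢ y<last
            x≢last = Fin.<⇒≢ (Fin.<-trans x<y y<last)
        in subst₂ Fin._<_ (sym (cong proj₁ (power-fixes a C.ε x≢last)))
             (sym (cong proj₁ (power-fixes a C.ε y≢last))) x<y
    ; avoids    = λ {x} x≢last eq → x≢last (trans (sym (cong proj₁ (power-fixes a C.ε x≢last))) eq)
    }

  s-unrotated : ∀ i x ρ → to (s i) (x , ρ) ≡ (Perm.transpose (pos i) (pos (suc i)) ⟨$⟩ʳ x , ρ)
  s-unrotated i x ρ = cong (Perm.transpose (pos i) (pos (suc i)) ⟨$⟩ʳ x ,_) (C.identityʳ ρ)

  -- The inserted card steps down by one position. The other cards avoid the upper of the two
  -- swapped positions, so no two of them change order.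
  s-inserts : ∀ {i c f} → suc (suc i) ℕ.≤ n → Inserts (pos (suc (suc i))) c f →
              Inserts (pos (suc i)) c (to (s (suc i)) ∘ f)
  s-inserts {i} {c} {f} 2+i≤n I = record
    { at-last   = λ ρ → trans (cong (to (s (suc i))) (at-last ρ)) (s-right (suc i) _)
    ; unrotated = λ x ρ x≢last → trans (cong (to (s (suc i))) (unrotated x ρ x≢last)) (s-unrotated (suc i) (proj₁ (f (x , C.ε))) ρ)
    ; monotone  = λ {x} {y} x<y y<last → transpose-mono (pos (suc i)) (pos (suc (suc i))) 2+i≡1+[1+i]
        {proj₁ (f (x , C.ε))} {proj₁ (f (y , C.ε))}
        (avoids {x} (Fin.<⇒≢ (ℕ.<-trans x<y y<last))) (avoids {y} (Fin.<⇒≢ y<last)) (monotone x<y y<last)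
    ; avoids    = λ {x} x≢last eq → avoids {x} x≢last (transpose-onto (pos (suc i)) (pos (suc (suc i))) eq)
    }
    where
    open Inserts I
    2+i≡1+[1+i] : toℕ (pos (suc (suc i))) ≡ suc (toℕ (pos (suc i)))
    2+i≡1+[1+i] = trans (toℕ-pos 2+i≤n) (cong suc (sym (toℕ-pos (ℕ.<⇒≤ 2+i≤n))))

  -- Each further factor on the left carries the inserted card one position towards the front, from
  -- `n ∸ k` to `n ∸ suc k`.
  cycle-inserts : ∀ k {c f} → k ℕ.< n → Inserts last c f → Inserts (pos (n ℕ.∸ k)) c (to (cycle k) ∘ f)
  cycle-inserts zero    k<n I = I
  -- `s-inserts` concerns `s (suc i)`; the index `n ∸ suc k` is positive because `suc k` is less
  -- than `n`.
  cycle-inserts (suc k) {c} {f} 1+k<n I = step (n ℕ.∸ suc k) (ℕ.m<n⇒0<n∸m 1+k<n)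
    (ℕ.≤-trans (ℕ.≤-reflexive (sym n∸k≡)) (ℕ.m∸n≤m n k))
    (subst (λ i → Inserts (pos i) c (to (cycle k) ∘ f)) n∸k≡ (cycle-inserts k (ℕ.<⇒≤ 1+k<n) I))
    where
    n∸k≡ : n ℕ.∸ k ≡ suc (n ℕ.∸ suc k)
    n∸k≡ = ℕ.+-∸-assoc 1 (ℕ.<⇒≤ 1+k<n)
    step : ∀ j {g} → 0 ℕ.< j → suc j ℕ.≤ n → Inserts (pos (suc j)) c g → Inserts (pos j) c (to (s j) ∘ g)
    step (suc i) _ 2+i≤n J = s-inserts 2+i≤n J

  module _ {p c} h (I : Inserts p c (to h)) where
    open Inserts I

    private
      h⁻¹ : E → E
      h⁻¹ = from h

      h∘h⁻¹ : ∀ e → to h (h⁻¹ e) ≡ e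
      h∘h⁻¹ = Inverse.strictlyInverseˡ (perm h)

    inverse-at : ∀ ρ → h⁻¹ (p , ρ) ≡ (last , ρ C.∙ c C.⁻¹)
    inverse-at ρ = trans (cong h⁻¹ (sym (trans (at-last (ρ C.∙ c C.⁻¹)) (cong (p ,_) (CP.//-rightDividesˡ c ρ)))))
      (Inverse.strictlyInverseʳ (perm h) _)

    inverse-≢last : ∀ {q} ρ → q ≢ p → proj₁ (h⁻¹ (q , ρ)) ≢ last
    inverse-≢last {q} ρ q≢p y≡last = q≢p (trans (sym (cong proj₁ (h∘h⁻¹ (q , ρ))))
      (trans (cong (λ y → proj₁ (to h (y , proj₂ (h⁻¹ (q , ρ))))) y≡last) (cong proj₁ (at-last _))))

    -- As `h` keeps the rotation of every card but the last, its inverse does so away from `p`. One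
    -- equation of pairs gives both the position, restored by `h`, and the unchanged rotation.
    inverse-split : ∀ {q} ρ → q ≢ p → (proj₁ (to h (proj₁ (h⁻¹ (q , ρ)) , C.ε)) , proj₂ (h⁻¹ (q , ρ))) ≡ (q , ρ)
    inverse-split {q} ρ q≢p = trans (sym (unrotated _ _ (inverse-≢last ρ q≢p))) (h∘h⁻¹ (q , ρ))

    -- A tie or a reversal of the preimages would be carried by `h` to a tie or a reversal of `q`
    -- and `q′`.
    inverse-mono : ∀ {q q′} ρ ρ′ → q ≢ p → q′ ≢ p → q Fin.< q′ →
                   proj₁ (h⁻¹ (q , ρ)) Fin.< proj₁ (h⁻¹ (q′ , ρ′))
    inverse-mono {q} {q′} ρ ρ′ q≢p q′≢p q<q′ with Fin.<-cmp (proj₁ (h⁻¹ (q , ρ))) (proj₁ (h⁻¹ (q′ , ρ′)))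
    ... | tri< y<y′ _ _ = y<y′
    ... | tri≈ _ y≡y′ _ = contradiction q<q′ (ℕ.<-irrefl (cong toℕ (trans (sym (cong proj₁ (inverse-split ρ q≢p)))
      (trans (cong (λ y → proj₁ (to h (y , C.ε))) y≡y′) (cong proj₁ (inverse-split ρ′ q′≢p))))))
    ... | tri> _ _ y′<y = contradiction q<q′ (ℕ.<-asym (subst₂ Fin._<_
      (cong proj₁ (inverse-split ρ′ q′≢p)) (cong proj₁ (inverse-split ρ q≢p))
      (monotone y′<y (<-last (inverse-≢last ρ q≢p)))))

  -- Decks with their first cards in order

  position : Element → Fin n → Fin n
  position g x = proj₁ (to g (x , C.ε))

  rotation : Element → Fin n → Fin m
  rotation g x = proj₂ (to g (x , C.ε))

  position-any : ∀ g x ρ → proj₁ (to g (x , ρ)) ≡ position g x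
  position-any g x ρ = cong proj₁ (equivariant g x ρ)

  positions : Element → Permutation′ n
  positions g = permutation (position g) (position (g ⁻¹))
    (λ y → trans (sym (position-any g _ _)) (cong proj₁ (Inverse.strictlyInverseˡ (perm g) (y , C.ε))))
    (λ x → trans (sym (position-any (g ⁻¹) _ _)) (cong proj₁ (Inverse.strictlyInverseʳ (perm g) (x , C.ε))))

  position-injective : ∀ g {x y} → position g x ≡ position g y → x ≡ y
  position-injective g = Injection.injective (↔⇒↣ (positions g))

  -- An element is read as a deck: `to g (x , C.ε)` tells where card `x` lies and how it is rotated,
  -- and left multiplication rearranges positions. For u at most n, a fraction 1 / (m^u u!) of all
  -- elements has this property.
  InOrder : ℕ → Element → Set
  InOrder u g = (∀ x → toℕ x ℕ.< u → rotation g x ≡ C.ε)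
              × (∀ x y → x Fin.< y → toℕ y ℕ.< u → position g x Fin.< position g y)

  inOrder? : ∀ u g → Dec (InOrder u g)
  inOrder? u g =
    (Fin.all? λ x → (toℕ x ℕ.<? u) →-dec (rotation g x Fin.≟ C.ε)) ×-dec
    (Fin.all? λ x → Fin.all? λ y → (x Fin.<? y) →-dec ((toℕ y ℕ.<? u) →-dec (position g x Fin.<? position g y)))

  inOrder-resp : ∀ {u} g g′ → (∀ x → toℕ x ℕ.< u → to g (x , C.ε) ≡ to g′ (x , C.ε)) → InOrder u g → InOrder u g′
  inOrder-resp g g′ g≗g′ (unrot , mono) =
    (λ x x<u → trans (sym (cong proj₂ (g≗g′ x x<u))) (unrot x x<u)) ,
    (λ x y x<y y<u → subst₂ Fin._<_ (cong proj₁ (g≗g′ x (ℕ.<-trans x<y y<u))) (cong proj₁ (g≗g′ y y<u)) (mono x y x<y y<u))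

  inOrder-0 : ∀ g → InOrder 0 g
  inOrder-0 g = (λ _ ()) , (λ _ _ _ ())

  inOrder-pred : ∀ {u g} → InOrder (suc u) g → InOrder u g
  inOrder-pred (unrot , mono) = (λ x x<u → unrot x (ℕ.m<n⇒m<1+n x<u)) , (λ x y x<y y<u → mono x y x<y (ℕ.m<n⇒m<1+n y<u))

  -- Here `g` permutes the positions monotonically, and so does its inverse. Both maps are
  -- inflationary, which forces the identity.
  inOrder-n : ∀ {g} → InOrder n g ⇔ g ≈ ε
  inOrder-n {g} = mk⇔ to-ε from-ε
    where
    from-ε : g ≈ ε → InOrder n g
    from-ε g≈ε = (λ x _ → cong proj₂ (g≈ε (x , C.ε))) ,
      (λ x y x<y _ → subst₂ Fin._<_ (sym (cong proj₁ (g≈ε (x , C.ε)))) (sym (cong proj₁ (g≈ε (y , C.ε)))) x<y)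

    to-ε : InOrder n g → g ≈ ε
    to-ε (unrot , mono) (x , ρ) = trans (equivariant g x ρ)
      (cong₂ _,_ position≡ (trans (cong (ρ C.∙_) (unrot x (Fin.toℕ<n x))) (C.identityʳ ρ)))
      where
      position-mono : ∀ {x y} → x Fin.< y → position g x Fin.< position g y
      position-mono {x} {y} x<y = mono x y x<y (Fin.toℕ<n y)

      card : Fin n → Fin n
      card = position (g ⁻¹)

      position-card : ∀ y → position g (card y) ≡ y
      position-card y = Perm.inverseʳ (positions g)

      card-mono : ∀ {y z} → y Fin.< z → card y Fin.< card z
      card-mono {y} {z} y<z with Fin.<-cmp (card y) (card z)
      ... | tri< c<d _ _ = c<d
      ... | tri≈ _ c≡d _ = contradiction y<z (ℕ.<-irrefl (cong toℕ
        (trans (sym (position-card y)) (trans (cong (position g) c≡d) (position-card z)))))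
      ... | tri> _ _ d<c = contradiction y<z (ℕ.<-asym
        (subst₂ Fin._<_ (position-card z) (position-card y) (position-mono d<c)))

      position≡ : position g x ≡ x
      position≡ = Fin.toℕ-injective (ℕ.≤-antisym
        (subst (λ z → toℕ (position g x) ℕ.≤ toℕ z) (Perm.inverseˡ (positions g))
          (monotone⇒inflationary card card-mono (position g x)))
        (monotone⇒inflationary (position g) position-mono x))

  -- The card c is the one that the shuffle h places at p, so that h ⁻¹ moves it to the last position.
  module _ {p κ h} (I : Inserts p κ (to h)) (f : Element) (c : Fin n) (c↦p : position f c ≡ p) where

    private
      h⁻¹f : Element
      h⁻¹f = h ⁻¹ ∙ f

      elsewhere : ∀ {x} → x ≢ c → position f x ≢ p
      elsewhere x≢c eq = x≢c (position-injective f (trans eq (sym c↦p)))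

      rotation-elsewhere : ∀ {x} → x ≢ c → rotation h⁻¹f x ≡ rotation f x
      rotation-elsewhere {x} x≢c = cong proj₂ (inverse-split h I (rotation f x) (elsewhere x≢c))

      mono-elsewhere : ∀ {x y} → x ≢ c → y ≢ c → position f x Fin.< position f y →
                       position h⁻¹f x Fin.< position h⁻¹f y
      mono-elsewhere x≢c y≢c = inverse-mono h I _ _ (elsewhere x≢c) (elsewhere y≢c)

      mono⁻¹-elsewhere : ∀ {x y} → x ≢ c → y ≢ c → position h⁻¹f x Fin.< position h⁻¹f y →
                         position f x Fin.< position f y
      mono⁻¹-elsewhere {x} {y} x≢c y≢c lt with Fin.<-cmp (position f x) (position f y)
      ... | tri< lt′ _ _ = lt′
      ... | tri≈ _ eq _ = contradiction lt (ℕ.<-irrefl (cong (toℕ ∘ position h⁻¹f) (position-injective f eq)))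
      ... | tri> _ _ gt = contradiction lt (ℕ.<-asym (mono-elsewhere y≢c x≢c gt))

      moved : to h⁻¹f (c , C.ε) ≡ (last , rotation f c C.∙ κ C.⁻¹)
      moved = trans (cong (λ q → from h (q , rotation f c)) c↦p) (inverse-at h I (rotation f c))

    -- The card `c` is not among the first `u`, and on all other cards the inverse shuffle preserves
    -- and reflects order and keeps the rotations.
    unmoved : ∀ {u} → u ℕ.≤ toℕ c → InOrder u h⁻¹f ⇔ InOrder u f
    unmoved {u} u≤c = mk⇔
      (λ (unrot , mono) → (λ x x<u → trans (sym (rotation-elsewhere (≢c x<u))) (unrot x x<u)) ,
        (λ x y x<y y<u → mono⁻¹-elsewhere (≢c (ℕ.<-trans x<y y<u)) (≢c y<u) (mono x y x<y y<u)))
      (λ (unrot , mono) → (λ x x<u → trans (rotation-elsewhere (≢c x<u)) (unrot x x<u)) ,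
        (λ x y x<y y<u → mono-elsewhere (≢c (ℕ.<-trans x<y y<u)) (≢c y<u) (mono x y x<y y<u)))
      where
      ≢c : ∀ {x} → toℕ x ℕ.< u → x ≢ c
      ≢c x<u refl = ℕ.<⇒≱ x<u u≤c

    -- After the inverse shuffle `c` lies at the last position, behind all smaller cards, so
    -- including it among the ordered cards only requires its new rotation to be trivial.
    moved-top : InOrder (suc (toℕ c)) h⁻¹f ⇔ (rotation f c C.∙ κ C.⁻¹ ≡ C.ε × InOrder (toℕ c) f)
    moved-top = mk⇔
      (λ o → trans (sym (cong proj₂ moved)) (proj₁ o c ℕ.≤-refl) ,
        Equivalence.to (unmoved (ℕ.≤-refl {toℕ c})) (inOrder-pred {g = h⁻¹f} o))
      (λ (unrot , o) → extend unrot (Equivalence.from (unmoved (ℕ.≤-refl {toℕ c})) o))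
      where
      extend : rotation f c C.∙ κ C.⁻¹ ≡ C.ε → InOrder (toℕ c) h⁻¹f → InOrder (suc (toℕ c)) h⁻¹f
      extend unrot-c (unrot , mono) = unrot′ , mono′
        where
        unrot′ : ∀ x → toℕ x ℕ.< suc (toℕ c) → rotation h⁻¹f x ≡ C.ε
        unrot′ x x<1+c with x Fin.≟ c
        ... | yes refl = trans (cong proj₂ moved) unrot-c
        ... | no x≢c   = unrot x (ℕ.≤∧≢⇒< (ℕ.≤-pred x<1+c) (x≢c ∘ Fin.toℕ-injective))

        mono′ : ∀ x y → x Fin.< y → toℕ y ℕ.< suc (toℕ c) → position h⁻¹f x Fin.< position h⁻¹f y
        mono′ x y x<y y<1+c with y Fin.≟ c
        ... | yes refl = subst (position h⁻¹f x Fin.<_) (sym (cong proj₁ moved))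
          (<-last (inverse-≢last h I _ (elsewhere (Fin.<⇒≢ x<y))))
        ... | no y≢c   = mono x y x<y (ℕ.≤∧≢⇒< (ℕ.≤-pred y<1+c) (y≢c ∘ Fin.toℕ-injective))

    -- The card `c` now lies last, yet the larger card `y` would have to lie behind it.
    moved-early : ∀ {u} (y : Fin n) → toℕ c ℕ.< toℕ y → toℕ y ℕ.< u → ¬ InOrder u h⁻¹f
    moved-early y c<y y<u (_ , mono) = ℕ.<⇒≱ (mono c y c<y y<u)
      (subst (λ q → position h⁻¹f y Fin.≤ q) (sym (cong proj₁ moved)) (≤-last _))

-- Coefficients in the group algebra as rational sums

module _ (𝔾 : Group 0ℓ 0ℓ) (_≟_ : Decidable (Group._≈_ 𝔾)) where
  open GroupAlgebra 𝔾 _≟_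

  coeff-sum : ∀ y g → ιℤ (coeff y g) ≡ sumOver y (λ (c , h) → ιℤ c * 𝟙 (h ≟ g))
  coeff-sum []            g = ι-0
  coeff-sum ((c , h) ∷ y) g with h ≟ g
  ... | yes _ = trans (ιℤ-+ c (coeff y g)) (cong₂ _+_ (sym (ℚ.*-identityʳ (ιℤ c))) (coeff-sum y g))
  ... | no _  = trans (coeff-sum y g)
    (trans (sym (ℚ.+-identityˡ _)) (cong (_+ sumOver y _) (sym (ℚ.*-zeroʳ (ιℤ c)))))

  sumOver-Σ< : ∀ N (g : ℕ → Group.Carrier 𝔾) F → sumOver (Σ< N (λ k → [ g k ])) F ≡ sumOver (upTo N) (λ k → F (ℤ.1ℤ , g k))
  sumOver-Σ< N g F = go (upTo N)
    where
    go : ∀ ks → sumOver (foldr _⊕_ 0# (map (λ k → [ g k ]) ks)) F ≡ sumOver ks (λ k → F (ℤ.1ℤ , g k))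
    go []       = refl
    go (k ∷ ks) = +-congˡ (F (ℤ.1ℤ , g k)) (go ks)

-- The random walk as an average over the shuffles

module Walk (m n : ℕ) .{{_ : NonZero m}} .{{_ : NonZero n}} where
  open G[_,1,_] m n
  open Shuffles m n
  module GP = GroupProperties group
  private instance
    mn≢0 : NonZero (m ℕ.* n)
    mn≢0 = ℕ.m*n≢0 m n

  Respects≈ : (Element → ℚ) → Set
  Respects≈ F = ∀ g g′ → g ≈ g′ → F g ≡ F g′

  χ : ℕ → Element → ℚ
  χ u g = 𝟙 (inOrder? u g)

  χ-cong : ∀ u → Respects≈ (χ u)
  χ-cong u g g′ g≈g′ = 𝟙-⇔ (mk⇔
    (inOrder-resp g g′ λ x _ → g≈g′ (x , C.ε))
    (inOrder-resp g′ g λ x _ → sym (g≈g′ (x , C.ε)))) (inOrder? u g) (inOrder? u g′)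

  shuffle : ℕ → ℕ → Element
  shuffle k a = cycle k ∙ power t[ n ] a

  shuffles : List Element
  shuffles = cartesianProductWith shuffle (upTo n) (upTo m)

  shuffle-inserts : ∀ {k} a → k ℕ.< n → Inserts (pos (n ℕ.∸ k)) (a mod m) (to (shuffle k a))
  shuffle-inserts {k} a k<n = cycle-inserts k k<n (power-inserts a)

  sum-shuffles : ∀ F → sumOver shuffles F ≡ sum {n} (λ i → sum {m} (λ a → F (shuffle (toℕ i) (toℕ a))))
  sum-shuffles F = trans (sumOver-cartesianProductWith shuffle (upTo n) (upTo m) F)
    (trans (sumOver-upTo _ n) (sum-cong-≗ {n} (λ i → sumOver-upTo _ m)))

  sum-shuffles-const : ∀ q → sumOver shuffles (λ _ → q) ≡ ι (m ℕ.* n) * q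
  sum-shuffles-const q = trans (sum-shuffles (λ _ → q))
    (trans (sum-cong-≗ {n} (λ _ → sum-const m q)) (trans (sum-const n (ι m * q))
    (trans (sym (ℚ.*-assoc (ι n) (ι m) q))
      (cong (_* q) (trans (ℚ.*-comm (ι n) (ι m)) (sym (ι-* m n)))))))

  -- Position p is hit by the shuffles with k = n - p; we sum over the card that f places there instead.
  shuffle-at : Element → Fin n → ℕ → Element
  shuffle-at f c a = shuffle (toℕ (Fin.opposite (position f c))) a

  sum-shuffles-by-card : ∀ f F → sumOver shuffles F ≡ sum {n} (λ c → sum {m} (λ a → F (shuffle-at f c (toℕ a))))
  sum-shuffles-by-card f F = trans (sum-shuffles F)
    (sum-permute (λ i → sum {m} (λ a → F (shuffle (toℕ i) (toℕ a)))) (positions f ∘ₚ Perm.reverse))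

  shuffle-at-inserts : ∀ f c a → Inserts (position f c) (a mod m) (to (shuffle-at f c a))
  shuffle-at-inserts f c a = subst (λ p → Inserts p (a mod m) (to (shuffle-at f c a))) pos≡
    (shuffle-inserts a (Fin.toℕ<n (Fin.opposite (position f c))))
    where
    pos≡ : pos (n ℕ.∸ toℕ (Fin.opposite (position f c))) ≡ position f c
    pos≡ = trans (cong (λ k → pos (n ℕ.∸ k)) (Fin.opposite-prop (position f c)))
      (trans (cong pos (ℕ.m∸[m∸n]≡n (Fin.toℕ<n (position f c)))) (pos-suc-toℕ (position f c)))

  -- The shuffles are split by the card that the inverse moves to the end, cards being counted from
  -- 0. A card before `u` gives 0 by `moved-early`; card `u` gives `χ u f` for exactly one rotation
  -- by `moved-top`; each of the `n ∸ suc u` later cards gives `χ (suc u) f` for all `m` rotations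
  -- by `unmoved`.
  χ-step : ∀ {u} → suc u ℕ.≤ n → ∀ f → sumOver shuffles (λ h → χ (suc u) (h ⁻¹ ∙ f))
           ≡ χ u f + ι (n ℕ.∸ suc u) * (ι m * χ (suc u) f)
  χ-step {u} u<n f = trans (sum-shuffles-by-card f _)
    (trans (sum-step top _ early (trans at-top (cong (λ v → χ v f) top≡u)) late)
      (cong (λ v → χ u f + ι (n ℕ.∸ suc v) * (ι m * χ (suc u) f)) top≡u))
    where
    top : Fin n
    top = Fin.fromℕ< u<n
    top≡u : toℕ top ≡ u
    top≡u = Fin.toℕ-fromℕ< u<n

    back : Fin n → ℕ → Element
    back c a = shuffle-at f c a ⁻¹ ∙ f

    term : Fin n → ℕ → ℚ
    term c a = χ (suc u) (back c a)

    early : ∀ c → toℕ c ℕ.< toℕ top → sum {m} (λ a → term c (toℕ a)) ≡ 0ℚ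
    early c c<top = trans (sum-cong-≗ {m} (λ a → 𝟙-false (inOrder? (suc u) (back c (toℕ a)))
      (moved-early {h = shuffle-at f c (toℕ a)} (shuffle-at-inserts f c (toℕ a)) f c refl top c<top
        (ℕ.s≤s (ℕ.≤-reflexive top≡u)))))
      (trans (sum-const m 0ℚ) (ℚ.*-zeroʳ (ι m)))

    late : ∀ c → toℕ top ℕ.< toℕ c → sum {m} (λ a → term c (toℕ a)) ≡ ι m * χ (suc u) f
    late c top<c = trans (sum-cong-≗ {m} (λ a → 𝟙-⇔
      (unmoved {h = shuffle-at f c (toℕ a)} (shuffle-at-inserts f c (toℕ a)) f c refl
        (subst (λ v → suc v ℕ.≤ toℕ c) top≡u top<c)) (inOrder? (suc u) (back c (toℕ a))) (inOrder? (suc u) f)))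
      (sum-const m _)

    top-term : ∀ (a : Fin m) → InOrder (suc u) (back top (toℕ a))
               ⇔ (rotation f top C.∙ a C.⁻¹ ≡ C.ε × InOrder (toℕ top) f)
    top-term a = subst₂ (λ v b → InOrder (suc v) (back top (toℕ a))
                          ⇔ (rotation f top C.∙ b C.⁻¹ ≡ C.ε × InOrder (toℕ top) f))
      top≡u (mod-toℕ a)
      (moved-top {h = shuffle-at f top (toℕ a)} (shuffle-at-inserts f top (toℕ a)) f top refl)

    at-top : sum {m} (λ a → term top (toℕ a)) ≡ χ (toℕ top) f
    -- Only the rotation equal to that of the top card cancels it, so `sum-step` is used with 0 on
    -- both sides.
    at-top = trans (sum-step (rotation f top) _ (λ a a< → misrotated a (Fin.<⇒≢ a<))
        (𝟙-⇔ (mk⇔ (λ o → proj₂ (Equivalence.to (top-term (rotation f top)) o))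
                  (λ o → Equivalence.from (top-term (rotation f top)) (C.inverseʳ (rotation f top) , o)))
             (inOrder? (suc u) (back top (toℕ (rotation f top)))) (inOrder? (toℕ top) f))
        (λ a a> → misrotated a (λ a≡ → Fin.<⇒≢ a> (sym a≡))))
      (trans (+-congˡ (χ (toℕ top) f) (ℚ.*-zeroʳ (ι (m ℕ.∸ suc (toℕ (rotation f top)))))) (ℚ.+-identityʳ _))
      where
      misrotated : ∀ a → a ≢ rotation f top → term top (toℕ a) ≡ 0ℚ
      misrotated a a≢ = 𝟙-false (inOrder? (suc u) (back top (toℕ a))) λ o →
        a≢ (sym (CP.x∙y⁻¹≈ε⇒x≈y (rotation f top) a (proj₁ (Equivalence.to (top-term a) o))))

  -- The transition operator

  T : (Element → ℚ) → Element → ℚ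
  T F g = ι⁻¹ (m ℕ.* n) * sumOver shuffles (λ h → F (h ⁻¹ ∙ g))

  P-sum : ∀ i j → P i j ≡ ι⁻¹ (m ℕ.* n) * sumOver shuffles (λ h → 𝟙 (h ∙ j ≟ i))
  -- The formal sums are lists of terms with coefficient 1, so expanding the products leaves one
  -- indicator per shuffle.
  P-sum i j = trans (/-ι⁻¹ (coeff (Sh ⊛ [ j ]) i) (m ℕ.* n)) (cong (ι⁻¹ (m ℕ.* n) *_) (
    trans (coeff-sum group _≟_ (Sh ⊛ [ j ]) i)
    (trans (sumOver-cartesianProductWith _ Sh [ j ] F)
    (trans (sumOver-cartesianProductWith _ (Σ< n (λ k → [ cycle k ])) (Σ< m (λ a → [ power t[ n ] a ])) _)
    (trans (sumOver-Σ< group _≟_ n cycle _)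
    (trans (sumOver-cong (upTo n) (λ k → trans (sumOver-Σ< group _≟_ m (power t[ n ]) _)
      (sumOver-cong (upTo m) (λ a → trans (ℚ.+-identityʳ _) (trans (cong (_* 𝟙 (shuffle k a ∙ j ≟ i)) ι-1) (ℚ.*-identityˡ _))))))
    (sym (sumOver-cartesianProductWith shuffle (upTo n) (upTo m) _))))))))
    where
    F : ℤ × Element → ℚ
    F (c , h) = ιℤ c * 𝟙 (h ≟ i)

  move : ∀ h i j → h ∙ j ≈ i ⇔ h ⁻¹ ∙ i ≈ j
  move h i j = mk⇔
    (λ hj≈i e → trans (cong (from h) (sym (hj≈i e))) (Inverse.strictlyInverseʳ (perm h) _))
    (λ h⁻¹i≈j e → trans (cong (to h) (sym (h⁻¹i≈j e))) (Inverse.strictlyInverseˡ (perm h) _))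

  -- For each shuffle `h` the only `l` with `h ∙ l ≈ i` is `h ⁻¹ ∙ i`, so exchanging the two sums
  -- leaves the average of `F` over these elements.
  ∑-P : ∀ F → Respects≈ F → ∀ i → ∑ (λ l → P i l * F l) ≡ T F i
  ∑-P F F-cong i = trans (sumOver-cong elements expand)
    (trans (sumOver-* elements (ι⁻¹ (m ℕ.* n)) _) (cong (ι⁻¹ (m ℕ.* n) *_)
    (trans (sumOver-swap elements shuffles (λ l h → 𝟙 (h ∙ l ≟ i) * F l))
    (sumOver-cong shuffles λ h → trans
      (sumOver-cong elements λ l → cong (_* F l) (𝟙-⇔ (move h i l) (h ∙ l ≟ i) (h ⁻¹ ∙ i ≟ l)))
      (sum-𝟙 finite (h ⁻¹ ∙ i) F (λ {g} {g′} → F-cong g g′))))))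
    where
    open FiniteDecSetoid finite using (elements)
    expand : ∀ l → P i l * F l ≡ ι⁻¹ (m ℕ.* n) * sumOver shuffles (λ h → 𝟙 (h ∙ l ≟ i) * F l)
    expand l = trans (cong (_* F l) (P-sum i l)) (trans (ℚ.*-assoc (ι⁻¹ (m ℕ.* n)) Σ𝟙 (F l)) (cong (ι⁻¹ (m ℕ.* n) *_)
      (trans (ℚ.*-comm Σ𝟙 (F l)) (trans (sym (sumOver-* shuffles (F l) (λ h → 𝟙 (h ∙ l ≟ i))))
        (sumOver-cong shuffles λ h → ℚ.*-comm (F l) (𝟙 (h ∙ l ≟ i)))))))
      where
      Σ𝟙 : ℚ
      Σ𝟙 = sumOver shuffles (λ h → 𝟙 (h ∙ l ≟ i))

  open FiniteDecSetoid finite using (elements)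

  T-const : ∀ q g → T (λ _ → q) g ≡ q
  T-const q g = trans (cong (ι⁻¹ (m ℕ.* n) *_) (sum-shuffles-const q)) (ι⁻¹-cancel (m ℕ.* n) q)

  P-rowSums : ∀ i → ∑ (λ j → P i j) ≡ 1ℚ
  P-rowSums i = trans (sumOver-cong elements λ j → sym (ℚ.*-identityʳ (P i j)))
    (trans (∑-P (λ _ → 1ℚ) (λ _ _ _ → refl) i) (T-const 1ℚ i))

  -- Each shuffle carries `j` to exactly one element, so the sum counts the shuffles.
  P-columnSums : ∀ j → ∑ (λ i → P i j) ≡ 1ℚ
  P-columnSums j = trans (sumOver-cong elements λ i → P-sum i j)
    (trans (sumOver-* elements (ι⁻¹ (m ℕ.* n)) _)
    (trans (cong (ι⁻¹ (m ℕ.* n) *_) (trans (sumOver-swap elements shuffles (λ i h → 𝟙 (h ∙ j ≟ i)))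
      (sumOver-cong shuffles λ h → trans (sumOver-cong elements λ i → sym (ℚ.*-identityʳ (𝟙 (h ∙ j ≟ i))))
        (sum-𝟙 finite (h ∙ j) (λ _ → 1ℚ) (λ _ → refl)))))
    (T-const 1ℚ j)))

  P-nonNegative : ∀ i j → 0ℚ ≤ P i j
  P-nonNegative i j = subst (0ℚ ≤_) (sym (P-sum i j))
    (0≤p*q (ℚ.<⇒≤ (0<ι⁻¹ (m ℕ.* n))) (sumOver-≥0 shuffles λ h → 0≤𝟙 (h ∙ j ≟ i)))

  P-doublyStochastic : IsDoublyStochastic P
  P-doublyStochastic = record
    { nonNegative = P-nonNegative
    ; rowSums     = P-rowSums
    ; columnSums  = P-columnSums
    }

-- Uniform densities and the powers of `P`

∣p-q∣≤1 : ∀ {p q} → 0ℚ ≤ p → p ≤ 1ℚ → 0ℚ ≤ q → q ≤ 1ℚ → ∣ p - q ∣ ≤ 1ℚ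
∣p-q∣≤1 {p} {q} 0≤p p≤1 0≤q q≤1 with ℚ.∣p∣≡p∨∣p∣≡-p (p - q)
... | inj₁ eq = subst (_≤ 1ℚ) (sym eq) (subst (p - q ≤_) (ℚ.+-identityʳ 1ℚ) (ℚ.+-mono-≤ p≤1 (ℚ.neg-antimono-≤ 0≤q)))
... | inj₂ eq = subst (_≤ 1ℚ) (sym (trans eq (flip p q)))
  (subst (q - p ≤_) (ℚ.+-identityʳ 1ℚ) (ℚ.+-mono-≤ q≤1 (ℚ.neg-antimono-≤ 0≤p)))
  where
  flip : ∀ p q → - (p - q) ≡ q - p
  flip = solve 2 (λ p q → :- (p :- q) := q :- p) refl

m^u*u!-mono : ∀ m .{{_ : NonZero m}} {u v} → u ℕ.≤′ v → m ℕ.^ u ℕ.* u ! ℕ.≤ m ℕ.^ v ℕ.* v !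
m^u*u!-mono m (ℕ.≤′-reflexive refl) = ℕ.≤-refl
m^u*u!-mono m (ℕ.≤′-step {v} u≤v)   = ℕ.≤-trans (m^u*u!-mono m u≤v)
  (ℕ.*-mono-≤ (ℕ.m≤n*m (m ℕ.^ v) m) (ℕ.m≤n*m (v !) (suc v)))

module Mixing (m n : ℕ) .{{_ : NonZero m}} .{{_ : NonZero n}} where
  open G[_,1,_] m n
  open Shuffles m n
  open Walk m n
  open FiniteDecSetoid finite using (elements)

  private instance
    mn≢0 : NonZero (m ℕ.* n)
    mn≢0 = ℕ.m*n≢0 m n
    m^n≢0 : NonZero (m ℕ.^ n)
    m^n≢0 = ℕ.m^n≢0 m n
    n!≢0 : NonZero (n !)
    n!≢0 = n ℕ.!≢0
    ∣G∣≢0 : NonZero (m ℕ.^ n ℕ.* n !)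
    ∣G∣≢0 = ℕ.m*n≢0 (m ℕ.^ n) (n !)

  ν≡ : 1/∣G∣ ≡ ι⁻¹ (m ℕ.^ n ℕ.* n !)
  ν≡ = 1/-ι⁻¹ (m ℕ.^ n ℕ.* n !)

  0<ν : 0ℚ < 1/∣G∣
  0<ν = subst (0ℚ <_) (sym ν≡) (0<ι⁻¹ (m ℕ.^ n ℕ.* n !))

  -- The reciprocal of the number of elements g with InOrder u g.
  density : ℕ → ℚ
  density u = ι (m ℕ.^ u ℕ.* u !) * 1/∣G∣

  density-0 : density 0 ≡ 1/∣G∣
  density-0 = trans (cong (_* 1/∣G∣) ι-1) (ℚ.*-identityˡ 1/∣G∣)

  density-n : density n ≡ 1ℚ
  density-n = trans (cong (ι (m ℕ.^ n ℕ.* n !) *_) ν≡)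
    (trans (ℚ.*-comm (ι (m ℕ.^ n ℕ.* n !)) _) (ι⁻¹-inverse (m ℕ.^ n ℕ.* n !)))

  density-suc : ∀ u → density (suc u) ≡ ι m * (ι (suc u) * density u)
  density-suc u = trans (cong (λ k → ι k * 1/∣G∣) (regroup u)) (trans (cong (_* 1/∣G∣)
    (trans (ι-* m _) (cong (ι m *_) (ι-* (suc u) _))))
    (reassoc (ι m) (ι (suc u)) (ι (m ℕ.^ u ℕ.* u !)) 1/∣G∣))
    where
    regroup : ∀ u → m ℕ.^ suc u ℕ.* suc u ! ≡ m ℕ.* (suc u ℕ.* (m ℕ.^ u ℕ.* u !))
    regroup u = trans (ℕ.*-assoc m (m ℕ.^ u) (suc u ℕ.* u !))
      (cong (m ℕ.*_) (trans (sym (ℕ.*-assoc (m ℕ.^ u) (suc u) (u !)))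
        (trans (cong (ℕ._* u !) (ℕ.*-comm (m ℕ.^ u) (suc u))) (ℕ.*-assoc (suc u) (m ℕ.^ u) (u !)))))
    reassoc : ∀ a b c d → a * (b * c) * d ≡ a * (b * (c * d))
    reassoc = solve 4 (λ a b c d → a :* (b :* c) :* d := a :* (b :* (c :* d))) refl

  0≤density : ∀ u → 0ℚ ≤ density u
  0≤density u = 0≤p*q (0≤ι (m ℕ.^ u ℕ.* u !)) (ℚ.<⇒≤ 0<ν)

  density≤1 : ∀ {u} → u ℕ.≤ n → density u ≤ 1ℚ
  density≤1 {u} u≤n = subst (density u ≤_) density-n
    (ℚ.*-monoʳ-≤-nonNeg 1/∣G∣ {{ℚ.nonNegative (ℚ.<⇒≤ 0<ν)}} (ι-mono (m^u*u!-mono m (ℕ.≤⇒≤′ u≤n))))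

  φ : ℕ → Element → ℚ
  φ u g = density u * χ u g

  φ-0 : ∀ g → φ 0 g ≡ 1/∣G∣
  φ-0 g = trans (cong₂ _*_ density-0 (𝟙-true (inOrder? 0 g) (inOrder-0 g))) (ℚ.*-identityʳ 1/∣G∣)

  φ-cong : ∀ u → Respects≈ (φ u)
  φ-cong u g g′ g≈g′ = cong (density u *_) (χ-cong u g g′ g≈g′)

  0≤φ : ∀ u g → 0ℚ ≤ φ u g
  0≤φ u g = 0≤p*q (0≤density u) (0≤𝟙 (inOrder? u g))

  φ≤1 : ∀ {u} → u ℕ.≤ n → ∀ g → φ u g ≤ 1ℚ
  φ≤1 {u} u≤n g = ℚ.≤-trans (*-monoˡ-≤ (0≤density u) (𝟙≤1 (inOrder? u g)))
    (subst (_≤ 1ℚ) (sym (ℚ.*-identityʳ (density u))) (density≤1 u≤n))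

  φ-n : ∀ i j → φ n (i ∙ j ⁻¹) ≡ 𝟙 (i ≟ j)
  φ-n i j = trans (cong₂ _*_ density-n (𝟙-⇔ (mk⇔
      (λ o → GP.x∙y⁻¹≈ε⇒x≈y i j (Equivalence.to (inOrder-n {i ∙ j ⁻¹}) o))
      (λ i≈j → Equivalence.from (inOrder-n {i ∙ j ⁻¹}) (GP.x≈y⇒x∙y⁻¹≈ε {i} {j} i≈j)))
      (inOrder? n (i ∙ j ⁻¹)) (i ≟ j)))
    (ℚ.*-identityˡ (𝟙 (i ≟ j)))

  -- One step of the pure-death chain: from `suc u` it stays with probability (n - u - 1) / n and
  -- drops to `u` with probability (u + 1) / n.
  average : ℕ → ℚ → ℚ → ℚ
  average u p q = ι⁻¹ n * (ι (n ℕ.∸ suc u) * p + ι (suc u) * q)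

  average-const : ∀ {u} → suc u ℕ.≤ n → ∀ q → average u q q ≡ q
  average-const {u} u<n q = trans (cong (ι⁻¹ n *_) (trans (sym (ℚ.*-distribʳ-+ q (ι (n ℕ.∸ suc u)) (ι (suc u))))
    (cong (_* q) (trans (sym (ι-+ (n ℕ.∸ suc u) (suc u))) (cong ι (ℕ.m∸n+n≡m u<n))))))
    (ι⁻¹-cancel n q)

  -- The ratio m (u + 1) of consecutive densities turns the coefficient 1 of `χ u` in `χ-step` into
  -- the coefficient m (u + 1) of `φ u`; dividing by m n then gives the weights of `average`.
  T-φ : ∀ {u} → suc u ℕ.≤ n → ∀ g → T (φ (suc u)) g ≡ average u (φ (suc u) g) (φ u g)
  T-φ {u} u<n g = trans (cong (ι⁻¹ (m ℕ.* n) *_) (trans (sumOver-* shuffles (density (suc u)) (λ h → χ (suc u) (h ⁻¹ ∙ g)))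
      (cong (density (suc u) *_) (χ-step u<n g))))
    (trans (cong₂ (λ a b → a * (density (suc u) * b)) (ι⁻¹-* m n) refl)
    -- To the ring solver `ι⁻¹ m` and `ι m` are independent variables. Their product is isolated and
    -- cancelled outside it, once in each summand.
    (trans (rearrange (ι⁻¹ m) (ι⁻¹ n) (density (suc u)) (χ u g) (ι (n ℕ.∸ suc u)) (ι m) (χ (suc u) g))
    (trans (cong₂ (λ a b → ι⁻¹ n * (a * (ι (n ℕ.∸ suc u) * φ (suc u) g) + ι⁻¹ m * (b * χ u g)))
      (ι⁻¹-inverse m) (density-suc u))
    (trans (rearrange′ (ι⁻¹ m) (ι⁻¹ n) (ι (n ℕ.∸ suc u) * φ (suc u) g) (ι m) (ι (suc u)) (density u) (χ u g))
      (cong (λ a → ι⁻¹ n * (ι (n ℕ.∸ suc u) * φ (suc u) g + a))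
        (trans (cong (_* (ι (suc u) * φ u g)) (ι⁻¹-inverse m)) (ℚ.*-identityˡ (ι (suc u) * φ u g))))))))
    where
    rearrange : ∀ M′ N′ d x K M y → M′ * N′ * (d * (x + K * (M * y))) ≡ N′ * (M′ * M * (K * (d * y)) + M′ * (d * x))
    rearrange = solve 7 (λ M′ N′ d x K M y → M′ :* N′ :* (d :* (x :+ K :* (M :* y)))
      := N′ :* (M′ :* M :* (K :* (d :* y)) :+ M′ :* (d :* x))) refl
    rearrange′ : ∀ M′ N′ Z M S d x → N′ * (1ℚ * Z + M′ * (M * (S * d) * x)) ≡ N′ * (Z + M′ * M * (S * (d * x)))
    rearrange′ = solve 7 (λ M′ N′ Z M S d x → N′ :* (con 1ℚ :* Z :+ M′ :* (M :* (S :* d) :* x))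
      := N′ :* (Z :+ M′ :* M :* (S :* (d :* x)))) refl

  -- Tᵏ φ_u, computed without T by iterating T-φ.
  W : ℕ → ℕ → Element → ℚ
  W zero    u       g = φ u g
  W (suc k) zero    g = W k zero g
  W (suc k) (suc u) g = average u (W k (suc u) g) (W k u g)

  W-0 : ∀ k g → W k 0 g ≡ 1/∣G∣
  W-0 zero    g = φ-0 g
  W-0 (suc k) g = W-0 k g

  W-cong : ∀ k u → Respects≈ (W k u)
  W-cong zero    u       g g′ g≈g′ = φ-cong u g g′ g≈g′
  W-cong (suc k) zero    g g′ g≈g′ = W-cong k zero g g′ g≈g′
  W-cong (suc k) (suc u) g g′ g≈g′ = cong₂ (average u) (W-cong k (suc u) g g′ g≈g′) (W-cong k u g g′ g≈g′)

  T-cong : ∀ {F F′} → (∀ g → F g ≡ F′ g) → ∀ g → T F g ≡ T F′ g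
  T-cong F≗F′ g = cong (ι⁻¹ (m ℕ.* n) *_) (sumOver-cong shuffles λ h → F≗F′ (h ⁻¹ ∙ g))

  T-average : ∀ u F F′ g → T (λ g → average u (F g) (F′ g)) g ≡ average u (T F g) (T F′ g)
  T-average u F F′ g = trans (cong (ι⁻¹ (m ℕ.* n) *_)
    (trans (sumOver-* shuffles (ι⁻¹ n) _) (cong (ι⁻¹ n *_)
    (trans (sumOver-+ shuffles _ _) (cong₂ _+_ (sumOver-* shuffles a _) (sumOver-* shuffles b _))))))
    (rearrange (ι⁻¹ (m ℕ.* n)) (ι⁻¹ n) a b
      (sumOver shuffles (λ h → F (h ⁻¹ ∙ g))) (sumOver shuffles (λ h → F′ (h ⁻¹ ∙ g))))
    where
    a b : ℚ
    a = ι (n ℕ.∸ suc u)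
    b = ι (suc u)
    rearrange : ∀ q r a b x y → q * (r * (a * x + b * y)) ≡ r * (a * (q * x) + b * (q * y))
    rearrange = solve 6 (λ q r a b x y → q :* (r :* (a :* x :+ b :* y)) := r :* (a :* (q :* x) :+ b :* (q :* y))) refl

  -- `T` is linear and therefore passes through `average`, so `T-φ` propagates from k = 0 to all k.
  T-W : ∀ k u → u ℕ.≤ n → ∀ g → T (W k u) g ≡ W (suc k) u g
  T-W zero    zero    _   g = trans (T-cong φ-0 g) (trans (T-const 1/∣G∣ g) (sym (φ-0 g)))
  T-W zero    (suc u) u<n g = T-φ u<n g
  T-W (suc k) zero    _   g = T-W k zero ℕ.z≤n g
  T-W (suc k) (suc u) u<n g = trans (T-average u (W k (suc u)) (W k u) g)
    (cong₂ (average u) (T-W k (suc u) u<n g) (T-W k u (ℕ.<⇒≤ u<n) g))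

  -- Left multiplication by shuffles commutes with right translation, so every column of `P ^ k` is
  -- a translate of the column at the identity.
  T-assoc : ∀ F → Respects≈ F → ∀ i j → T (λ l → F (l ∙ j ⁻¹)) i ≡ T F (i ∙ j ⁻¹)
  T-assoc F F-cong i j = cong (ι⁻¹ (m ℕ.* n) *_) (sumOver-cong shuffles λ h →
    F-cong (h ⁻¹ ∙ i ∙ j ⁻¹) (h ⁻¹ ∙ (i ∙ j ⁻¹)) (λ _ → refl))

  ∑-P-translate : ∀ F → Respects≈ F → ∀ i j → ∑ (λ l → P i l * F (l ∙ j ⁻¹)) ≡ T F (i ∙ j ⁻¹)
  ∑-P-translate F F-cong i j = trans
    (∑-P (λ l → F (l ∙ j ⁻¹)) (λ g g′ g≈g′ → F-cong (g ∙ j ⁻¹) (g′ ∙ j ⁻¹) (λ e → g≈g′ (from j e))) i)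
    (T-assoc F F-cong i j)

  -- The powers start from `φ n`, the point mass at the identity, and each factor `P` applies `T`
  -- once more.
  P^k≡W : ∀ k i j → (P ^ k) i j ≡ W k n (i ∙ j ⁻¹)
  P^k≡W zero    i j = sym (φ-n i j)
  P^k≡W (suc k) i j = trans (sumOver-cong elements λ l → cong (P i l *_) (P^k≡W k l j))
    (trans (∑-P-translate (W k n) (W-cong k n) i j) (T-W k n ℕ.≤-refl (i ∙ j ⁻¹)))

  -- Computed directly from the shuffles, since `P ^ 1` unfolds to `P ⊗ identity` rather than to
  -- `P`.
  P≡W : ∀ i j → P i j ≡ W 1 n (i ∙ j ⁻¹)
  P≡W i j = trans (P-sum i j) (trans
    (cong (ι⁻¹ (m ℕ.* n) *_) (sumOver-cong shuffles λ h →
      trans (𝟙-⇔ (move h i j) (h ∙ j ≟ i) (h ⁻¹ ∙ i ≟ j)) (sym (φ-n (h ⁻¹ ∙ i) j))))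
    (trans (T-assoc (φ n) (φ-cong n) i j) (T-W 0 n ℕ.≤-refl (i ∙ j ⁻¹))))

  -- Ergodicity

  0≤average : ∀ u {p q} → 0ℚ ≤ p → 0ℚ ≤ q → 0ℚ ≤ average u p q
  0≤average u 0≤p 0≤q = 0≤p*q (ℚ.<⇒≤ (0<ι⁻¹ n))
    (ℚ.+-mono-≤ (0≤p*q (0≤ι (n ℕ.∸ suc u)) 0≤p) (0≤p*q (0≤ι (suc u)) 0≤q))

  0≤W : ∀ k u g → 0ℚ ≤ W k u g
  0≤W zero    u       g = 0≤φ u g
  0≤W (suc k) zero    g = 0≤W k zero g
  0≤W (suc k) (suc u) g = 0≤average u (0≤W k (suc u) g) (0≤W k u g)

  -- Dropping `u` times in a row has positive weight and leads to `φ 0`, which is positive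
  -- everywhere.
  0<W : ∀ {k u} → u ℕ.≤ k → ∀ g → 0ℚ < W k u g
  0<W {k} ℕ.z≤n g = subst (0ℚ <_) (sym (W-0 k g)) 0<ν
  0<W {suc k} {suc u} (ℕ.s≤s u≤k) g = 0<p*q (0<ι⁻¹ n)
    (ℚ.+-mono-≤-< (0≤p*q (0≤ι (n ℕ.∸ suc u)) (0≤W k (suc u) g)) (0<p*q (0<ι (suc u)) (0<W u≤k g)))

  0<P^k : ∀ {k} → n ℕ.≤ k → ∀ i j → 0ℚ < (P ^ k) i j
  0<P^k {k} n≤k i j = subst (0ℚ <_) (sym (P^k≡W k i j)) (0<W n≤k (i ∙ j ⁻¹))

  P-ergodic : Ergodic P
  P-ergodic = (λ i j → n , ℕ.>-nonZero⁻¹ n , 0<P^k ℕ.≤-refl i j) ,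
    -- Both n and n + 1 are return times, so `d` divides their difference 1.
    (λ i d d∣ → ∣1⇒≡1 (∣m+n∣m⇒∣n
      (d∣ (n ℕ.+ 1) (ℕ.m≤n+m 1 n) (0<P^k (ℕ.m≤m+n n 1) i i))
      (d∣ n (ℕ.>-nonZero⁻¹ n) (0<P^k ℕ.≤-refl i i))))

  -- Rate of convergence

  -- `C` is an eigenfunction of the death chain that dominates the initial deviations. By the
  -- triangle inequality `average` preserves the domination, and it multiplies `C` by `r`.
  W-bound : ∀ (C : ℕ → ℚ) r → C 0 ≡ 0ℚ →
    (∀ u → u ℕ.≤ n → ∀ g → ∣ φ u g - 1/∣G∣ ∣ ≤ C u) →
    (∀ u → suc u ℕ.≤ n → average u (C (suc u)) (C u) ≡ r * C (suc u)) →
    ∀ k u → u ℕ.≤ n → ∀ g → ∣ W k u g - 1/∣G∣ ∣ ≤ C u * r ^ℚ k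
  W-bound C r C0≡0 base rec = go
    where
    ν = 1/∣G∣
    go : ∀ k u → u ℕ.≤ n → ∀ g → ∣ W k u g - ν ∣ ≤ C u * r ^ℚ k
    go zero    u       u≤n g = subst (∣ φ u g - ν ∣ ≤_) (sym (ℚ.*-identityʳ (C u))) (base u u≤n g)
    -- At u = 0 the bound is 0 for every exponent, because `C 0` vanishes.
    go (suc k) zero    _   g = subst (∣ W k 0 g - ν ∣ ≤_)
      (trans (cong (_* r ^ℚ k) C0≡0) (trans (ℚ.*-zeroˡ (r ^ℚ k))
        (sym (trans (cong (_* (r * r ^ℚ k)) C0≡0) (ℚ.*-zeroˡ (r * r ^ℚ k))))))
      (go k zero ℕ.z≤n g)
    go (suc k) (suc u) u<n g = begin
      -- Writing the uniform value as its own average turns the deviation into the average of the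
      -- two deviations.
      ∣ average u x y - ν ∣                     ≡⟨ cong (λ z → ∣ average u x y - z ∣) (average-const u<n ν) ⟨
      ∣ average u x y - average u ν ν ∣         ≡⟨ cong ∣_∣ (difference (ι⁻¹ n) a b x y ν) ⟩
      ∣ ι⁻¹ n * (a * (x - ν) + b * (y - ν)) ∣   ≡⟨ scale (0<⇒0≤ (0<ι⁻¹ n)) _ ⟩
      ι⁻¹ n * ∣ a * (x - ν) + b * (y - ν) ∣     ≤⟨ *-monoˡ-≤ (0<⇒0≤ (0<ι⁻¹ n)) (ℚ.∣p+q∣≤∣p∣+∣q∣ (a * (x - ν)) (b * (y - ν))) ⟩
      ι⁻¹ n * (∣ a * (x - ν) ∣ + ∣ b * (y - ν) ∣)
        ≡⟨ cong (ι⁻¹ n *_) (cong₂ _+_ (scale (0≤ι (n ℕ.∸ suc u)) (x - ν)) (scale (0≤ι (suc u)) (y - ν))) ⟩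
      ι⁻¹ n * (a * ∣ x - ν ∣ + b * ∣ y - ν ∣)
        ≤⟨ *-monoˡ-≤ (0<⇒0≤ (0<ι⁻¹ n)) (ℚ.+-mono-≤
             (*-monoˡ-≤ (0≤ι (n ℕ.∸ suc u)) (go k (suc u) u<n g))
             (*-monoˡ-≤ (0≤ι (suc u)) (go k u (ℕ.<⇒≤ u<n) g))) ⟩
      average u (C (suc u) * r ^ℚ k) (C u * r ^ℚ k)  ≡⟨ factor (ι⁻¹ n) a b (C (suc u)) (C u) (r ^ℚ k) ⟩
      average u (C (suc u)) (C u) * r ^ℚ k           ≡⟨ cong (_* r ^ℚ k) (rec u u<n) ⟩
      r * C (suc u) * r ^ℚ k                         ≡⟨ commute r (C (suc u)) (r ^ℚ k) ⟩
      C (suc u) * (r * r ^ℚ k)                       ∎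
      where
      open ℚ.≤-Reasoning
      0<⇒0≤ = ℚ.<⇒≤
      x = W k (suc u) g
      y = W k u g
      a = ι (n ℕ.∸ suc u)
      b = ι (suc u)
      scale : ∀ {p} → 0ℚ ≤ p → ∀ q → ∣ p * q ∣ ≡ p * ∣ q ∣
      scale {p} 0≤p q = trans (ℚ.∣p*q∣≡∣p∣*∣q∣ p q) (cong (_* ∣ q ∣) (ℚ.0≤p⇒∣p∣≡p 0≤p))
      difference : ∀ c a b x y z → c * (a * x + b * y) - c * (a * z + b * z) ≡ c * (a * (x - z) + b * (y - z))
      difference = solve 6 (λ c a b x y z → c :* (a :* x :+ b :* y) :- c :* (a :* z :+ b :* z)
        := c :* (a :* (x :- z) :+ b :* (y :- z))) refl
      factor : ∀ c a b x y p → c * (a * (x * p) + b * (y * p)) ≡ c * (a * x + b * y) * p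
      factor = solve 6 (λ c a b x y p → c :* (a :* (x :* p) :+ b :* (y :* p)) := c :* (a :* x :+ b :* y) :* p) refl
      commute : ∀ r c p → r * c * p ≡ c * (r * p)
      commute = solve 3 (λ r c p → r :* c :* p := c :* (r :* p)) refl

  -- Dominates both eigenfunctions at u = n, namely n and n (n - 1), so one constant serves both
  -- rates.
  α : ℚ
  α = ι (n ℕ.* n)

  -- The case u = n of `W-bound` for integral eigenfunctions; `rec` is the eigenvalue equation
  -- multiplied by n.
  P-bound : ∀ (c : ℕ → ℕ) z → c 0 ≡ 0 → c n ℕ.≤ n ℕ.* n →
    0ℚ ≤ z / n →
    (∀ u → u ℕ.≤ n → ∀ g → ∣ φ u g - 1/∣G∣ ∣ ≤ ι (c u)) →
    (∀ u → suc u ℕ.≤ n → ι (n ℕ.∸ suc u) * ι (c (suc u)) + ι (suc u) * ι (c u) ≡ ιℤ z * ι (c (suc u))) →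
    ConvergesAtRate α (z / n)
  P-bound c z c0≡0 cn≤ 0≤z/n base rec k _ i j = ℚ.≤-trans
    (subst (λ p → ∣ p - 1/∣G∣ ∣ ≤ ι (c n) * (z / n) ^ℚ k) (sym (P^k≡W k i j))
      (W-bound (ι ∘ c) (z / n) (trans (cong ι c0≡0) ι-0) base
        (λ u u<n → trans (cong (ι⁻¹ n *_) (rec u u<n))
          (trans (sym (ℚ.*-assoc (ι⁻¹ n) (ιℤ z) (ι (c (suc u))))) (cong (_* ι (c (suc u))) (sym (/-ι⁻¹ z n)))))
        k n ℕ.≤-refl (i ∙ j ⁻¹)))
    (ℚ.*-monoʳ-≤-nonNeg ((z / n) ^ℚ k) {{ℚ.nonNegative (0≤^ k)}} (ι-mono cn≤))
    where
    0≤^ : ∀ k → 0ℚ ≤ (z / n) ^ℚ k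
    0≤^ zero    = ℚ.nonNegative⁻¹ 1ℚ
    0≤^ (suc k) = 0≤p*q 0≤z/n (0≤^ k)

length-cartesianProductWith : ∀ {A B C : Set} (f : A → B → C) xs ys →
  length (cartesianProductWith f xs ys) ≡ length xs ℕ.* length ys
length-cartesianProductWith f []       ys = refl
length-cartesianProductWith f (x ∷ xs) ys = trans (List.length-++ (map (f x) ys))
  (cong₂ ℕ._+_ (List.length-map (f x) ys) (length-cartesianProductWith f xs ys))

-- Null sequences

Null : (ℕ → ℚ) → Set
Null s = ∀ ε → 0ℚ < ε → ∃[ N ] (∀ k → N ℕ.≤ k → ∣ s k ∣ < ε)

null-≗ : ∀ {s t} → (∀ k → s k ≡ t k) → Null s → Null t
null-≗ s≗t s-null ε 0<ε =
  let N , small = s-null ε 0<ε in N , λ k N≤k → subst (λ q → ∣ q ∣ < ε) (s≗t k) (small k N≤k)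

null-0 : Null (λ _ → 0ℚ)
null-0 ε 0<ε = 0 , λ _ _ → 0<ε

null-+ : ∀ {s t} → Null s → Null t → Null (λ k → s k + t k)
null-+ {s} {t} s-null t-null ε 0<ε =
  let 0<½ε      = 0<p*q {½} (ℚ.positive⁻¹ ½) 0<ε
      M , s-small = s-null (½ * ε) 0<½ε
      N , t-small = t-null (½ * ε) 0<½ε
  in M ℕ.⊔ N , λ k M⊔N≤k → ℚ.≤-<-trans (ℚ.∣p+q∣≤∣p∣+∣q∣ (s k) (t k))
    (subst (∣ s k ∣ + ∣ t k ∣ <_) (trans (sym (ℚ.*-distribʳ-+ ε ½ ½)) (ℚ.*-identityˡ ε))
      (ℚ.+-mono-< (s-small k (ℕ.m⊔n≤o⇒m≤o M N M⊔N≤k)) (t-small k (ℕ.m⊔n≤o⇒n≤o M N M⊔N≤k))))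

null-* : ∀ q {s} → Null s → Null (λ k → q * s k)
null-* q {s} s-null ε 0<ε =
  let N , small = s-null (1/c * ε) (0<p*q (ℚ.positive⁻¹ 1/c) 0<ε)
  in N , λ k N≤k → begin-strict
    ∣ q * s k ∣     ≡⟨ ℚ.∣p*q∣≡∣p∣*∣q∣ q (s k) ⟩
    ∣ q ∣ * ∣ s k ∣ ≤⟨ ℚ.*-monoʳ-≤-nonNeg ∣ s k ∣ {{ℚ.∣-∣-nonNeg (s k)}} (p≤p+q ∣ q ∣ (ℚ.nonNegative⁻¹ 1ℚ)) ⟩
    c * ∣ s k ∣     <⟨ ℚ.*-monoʳ-<-pos c (small k N≤k) ⟩
    c * (1/c * ε)   ≡⟨ ℚ.*-assoc c 1/c ε ⟨
    c * 1/c * ε     ≡⟨ cong (_* ε) (ℚ.*-inverseʳ c) ⟩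
    1ℚ * ε          ≡⟨ ℚ.*-identityˡ ε ⟩
    ε               ∎
  where
  open ℚ.≤-Reasoning
  -- The added 1 makes the divisor positive even when `q` is 0.
  c : ℚ
  c = ∣ q ∣ + 1ℚ
  instance
    c-positive : ℚ.Positive c
    c-positive = ℚ.nonNeg+pos⇒pos ∣ q ∣ {{ℚ.∣-∣-nonNeg q}} 1ℚ
    c-nonZero : ℚ.NonZero c
    c-nonZero = ℚ.pos⇒nonZero c
  1/c : ℚ
  1/c = 1/ c
  instance
    1/c-positive : ℚ.Positive 1/c
    1/c-positive = ℚ.1/pos⇒pos c

null-sum : ∀ {A : Set} (xs : List A) {s : A → ℕ → ℚ} → (∀ x → Null (s x)) → Null (λ k → sumOver xs (λ x → s x k))
null-sum []       s-null = null-0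
null-sum (x ∷ xs) s-null = null-+ (s-null x) (null-sum xs s-null)

-- The relation `≃` unfolds to `Null` of the termwise differences, which are all 0 here.
≡⇒≃ : ∀ {x y} → (∀ k → seq x k ≡ seq y k) → x ≃ y
≡⇒≃ {x} {y} x≗y = null-≗ (λ k → sym (trans (cong (_- seq y k) (x≗y k)) (ℚ.+-inverseʳ (seq y k)))) null-0

-- The eigenfunctions behind the two rates

Fin1-unique : ∀ {m} → m ≡ 1 → (i j : Fin m) → i ≡ j
Fin1-unique refl Fin.zero Fin.zero = refl

+-∸-pos : ∀ {k n} → k ℕ.≤ n → + n ℤ.- + k ≡ + (n ℕ.∸ k)
+-∸-pos {k} {n} k≤n = trans (ℤ.m-n≡m⊖n n k) (ℤ.⊖-≥ k≤n)

∸-split : ∀ k v {n} → k ℕ.+ v ℕ.≤ n → n ℕ.∸ (k ℕ.+ v) ℕ.+ v ≡ n ℕ.∸ k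
∸-split k v {n} k+v≤n = trans (cong (ℕ._+ v) (sym (ℕ.∸-+-assoc n k v)))
  (ℕ.m∸n+n≡m (ℕ.m+n≤o⇒m≤o∸n v (subst (ℕ._≤ n) (ℕ.+-comm k v) k+v≤n)))

module Conclusion (m n : ℕ) .{{_ : NonZero m}} .{{_ : NonZero n}} where
  open G[_,1,_] m n
  open Shuffles m n
  open Walk m n
  open Mixing m n
  open FiniteDecSetoid finite using (elements)

  0≤[n-k]/n : ∀ {k} → k ℕ.≤ n → 0ℚ ≤ (+ n ℤ.- + k) / n
  0≤[n-k]/n {k} k≤n = subst (0ℚ ≤_) (sym (/-ι⁻¹ (+ n ℤ.- + k) n))
    (0≤p*q (ℚ.<⇒≤ (0<ι⁻¹ n)) (subst (λ z → 0ℚ ≤ ιℤ z) (sym (+-∸-pos k≤n)) (0≤ι (n ℕ.∸ k))))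

  -- With v = u + 1 - k this is the form in which the eigenvalue n - k comes out of the eigenvalue
  -- equations: the weight of staying plus a remainder.
  ιℤ[n-k] : ∀ k v → k ℕ.+ v ℕ.≤ n → ιℤ (+ n ℤ.- + k) ≡ ι (n ℕ.∸ (k ℕ.+ v)) + ι v
  ιℤ[n-k] k v k+v≤n = trans (cong ιℤ (+-∸-pos (ℕ.m+n≤o⇒m≤o k k+v≤n)))
    (trans (cong ι (sym (∸-split k v k+v≤n))) (ι-+ (n ℕ.∸ (k ℕ.+ v)) v))

  1/∣G∣≤1 : 1/∣G∣ ≤ 1ℚ
  1/∣G∣≤1 = subst (_≤ 1ℚ) density-0 (density≤1 {0} ℕ.z≤n)

  φ-deviation≤1 : ∀ {u} → u ℕ.≤ n → ∀ g → ∣ φ u g - 1/∣G∣ ∣ ≤ 1ℚ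
  φ-deviation≤1 {u} u≤n g = ∣p-q∣≤1 (0≤φ u g) (φ≤1 u≤n g) (ℚ.<⇒≤ 0<ν) 1/∣G∣≤1

  no-deviation : ∀ {p} k → p ≡ 1/∣G∣ → ∣ p - 1/∣G∣ ∣ ≤ ι k
  no-deviation k refl = subst (λ q → ∣ q ∣ ≤ ι k) (sym (ℚ.+-inverseʳ 1/∣G∣)) (0≤ι k)

  1≤ι : ∀ k .{{_ : NonZero k}} → 1ℚ ≤ ι k
  1≤ι k = subst (_≤ ι k) ι-1 (ι-mono (ℕ.>-nonZero⁻¹ k))

  -- The eigenfunction is u. It dominates the deviations because they are at most 1, and 0 for u =
  -- 0.
  rate[n-1]/n : ConvergesAtRate α ((+ n ℤ.- + 1) / n)
  rate[n-1]/n = P-bound id (+ n ℤ.- + 1) refl (ℕ.m≤m*n n n) (0≤[n-k]/n (ℕ.>-nonZero⁻¹ n)) base rec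
    where
    base : ∀ u → u ℕ.≤ n → ∀ g → ∣ φ u g - 1/∣G∣ ∣ ≤ ι u
    base zero    _   g = no-deviation 0 (φ-0 g)
    base (suc u) u<n g = ℚ.≤-trans (φ-deviation≤1 u<n g) (1≤ι (suc u))

    rec : ∀ u → suc u ℕ.≤ n →
          ι (n ℕ.∸ suc u) * ι (suc u) + ι (suc u) * ι u ≡ ιℤ (+ n ℤ.- + 1) * ι (suc u)
    rec u u<n = trans (factor (ι (n ℕ.∸ suc u)) (ι (suc u)) (ι u)) (cong (_* ι (suc u)) (sym (ιℤ[n-k] 1 u u<n)))
      where
      factor : ∀ a b c → a * b + b * c ≡ (a + c) * b
      factor = solve 3 (λ a b c → a :* b :+ b :* c := (a :+ c) :* b) refl

  -- The eigenfunction u (u - 1) also vanishes at u = 1, where the deviation is 0 as well: with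
  -- trivial rotations, a single card is always in order.
  rate[n-2]/n : m ≡ 1 → 2 ℕ.≤ n → ConvergesAtRate α ((+ n ℤ.- + 2) / n)
  rate[n-2]/n m≡1 2≤n = P-bound (λ u → u ℕ.* ℕ.pred u) (+ n ℤ.- + 2) refl
    (ℕ.*-monoʳ-≤ n ℕ.pred[n]≤n) (0≤[n-k]/n 2≤n) base rec
    where
    φ-1 : ∀ g → φ 1 g ≡ 1/∣G∣
    φ-1 g = trans (cong₂ _*_ density-1 (𝟙-true (inOrder? 1 g)
      ((λ x _ → Fin1-unique m≡1 (rotation g x) C.ε) ,
       (λ x y x<y y<1 → contradiction x<y (ℕ.≤⇒≯ (ℕ.≤-trans (ℕ.≤-pred y<1) ℕ.z≤n))))))
      (ℚ.*-identityʳ 1/∣G∣)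
      where
      density-1 : density 1 ≡ 1/∣G∣
      density-1 = trans (density-suc 0) (trans (cong₂ _*_ (trans (cong ι m≡1) ι-1) (cong₂ _*_ ι-1 density-0))
        (trans (ℚ.*-identityˡ (1ℚ * 1/∣G∣)) (ℚ.*-identityˡ 1/∣G∣)))

    base : ∀ u → u ℕ.≤ n → ∀ g → ∣ φ u g - 1/∣G∣ ∣ ≤ ι (u ℕ.* ℕ.pred u)
    base zero          _   g = no-deviation 0 (φ-0 g)
    base (suc zero)    _   g = no-deviation 0 (φ-1 g)
    base (suc (suc v)) v<n g = ℚ.≤-trans (φ-deviation≤1 v<n g) (1≤ι (suc (suc v) ℕ.* suc v))

    rec : ∀ u → suc u ℕ.≤ n →
          ι (n ℕ.∸ suc u) * ι (suc u ℕ.* u) + ι (suc u) * ι (u ℕ.* ℕ.pred u) ≡ ιℤ (+ n ℤ.- + 2) * ι (suc u ℕ.* u)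
    -- The equation at u = 0 involves the eigenfunction only at 0 and 1, where it vanishes.
    rec zero    _   = trans (cong₂ _+_ (vanish (ι (n ℕ.∸ 1))) (vanish (ι 1))) (sym (vanish (ιℤ (+ n ℤ.- + 2))))
      where
      vanish : ∀ q → q * ι 0 ≡ 0ℚ
      vanish q = trans (cong (q *_) ι-0) (ℚ.*-zeroʳ q)
    rec (suc v) v<n = trans (cong₂ (λ p q → K * p + A * q) (ι-* (suc (suc v)) (suc v)) (ι-* (suc v) v))
      (trans (factor K A (ι (suc v)) (ι v))
        (cong₂ _*_ (sym (ιℤ[n-k] 2 v v<n)) (sym (ι-* (suc (suc v)) (suc v)))))
      where
      K A : ℚ
      K = ι (n ℕ.∸ suc (suc v))
      A = ι (suc (suc v))
      factor : ∀ k a b v → k * (a * b) + a * (b * v) ≡ (k + v) * (a * b)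
      factor = solve 4 (λ k a b v → k :* (a :* b) :+ a :* (b :* v) := (k :+ v) :* (a :* b)) refl

  0<α : 0ℚ < α
  0<α = 0<ι (n ℕ.* n) {{ℕ.m*n≢0 n n}}

  -- Stationary distributions

  seq-∑ℝ : ∀ (f : Element → ℝ) k → seq (∑ℝ f) k ≡ ∑ (λ j → seq (f j) k)
  seq-∑ℝ f k = go elements
    where
    go : ∀ xs → seq (foldr _+ℝ_ (fromℚ 0ℚ) (map f xs)) k ≡ sumOver xs (λ j → seq (f j) k)
    go []       = refl
    go (x ∷ xs) = +-congˡ (seq (f x) k) (go xs)

  length-permutations : ∀ l → length (permutations l) ≡ l !
  length-permutations zero    = refl
  length-permutations (suc l) = trans (length-cartesianProductWith _ (allFin (suc l)) (permutations l))
    (cong₂ ℕ._*_ (List.length-tabulate {n = suc l} id) (length-permutations l))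

  length-vectors : ∀ l → length (vectors l) ≡ m ℕ.^ l
  length-vectors zero    = refl
  length-vectors (suc l) = trans (length-cartesianProductWith _ (allFin m) (vectors l))
    (cong₂ ℕ._*_ (List.length-tabulate {n = m} id) (length-vectors l))

  length-elements : length elements ≡ m ℕ.^ n ℕ.* n !
  length-elements = trans (length-cartesianProductWith _ (permutations n) (vectors n))
    (trans (cong₂ ℕ._*_ (length-permutations n) (length-vectors n)) (ℕ.*-comm (n !) (m ℕ.^ n)))

  ∑-uniform : ∑ (λ _ → 1/∣G∣) ≡ 1ℚ
  ∑-uniform = trans (sumOver-const elements 1/∣G∣) (trans (cong (λ k → ι k * 1/∣G∣) length-elements) density-n)

  uniform-stationary : IsStationary P uniform
  uniform-stationary = record
    { isProbabilityDistribution = record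
      { μ-cong      = λ _ → ≡⇒≃ {uniform ε} {uniform ε} (λ _ → refl)
      ; nonNegative = λ _ δ 0<δ → 0 , λ _ _ → ℚ.<-trans (ℚ.neg-antimono-< 0<δ) 0<ν
      ; total       = ≡⇒≃ {∑ℝ uniform} {fromℚ 1ℚ} (λ k → trans (seq-∑ℝ uniform k) ∑-uniform)
      }
    ; invariant = λ i → ≡⇒≃ {∑ℝ (λ j → P i j · uniform j)} {uniform i} (λ k →
        trans (seq-∑ℝ (λ j → P i j · uniform j) k)
        (trans (sumOver-cong elements λ j → ℚ.*-comm (P i j) 1/∣G∣)
        (trans (sumOver-* elements 1/∣G∣ (P i))
        (trans (cong (1/∣G∣ *_) (P-rowSums i)) (ℚ.*-identityʳ 1/∣G∣)))))
    }

  module _ (μ : Element → ℝ) (μ-stationary : IsStationary P μ) where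
    open IsStationary μ-stationary
    open IsProbabilityDistribution isProbabilityDistribution using (total)

    private
      x : ℕ → Element → ℚ
      x N j = seq (μ j) N

      φ*x : ℕ → ℕ → Element → ℚ
      φ*x u N i = ∑ (λ j → φ u (i ∙ j ⁻¹) * x N j)

      Px-x-null : ∀ i → Null (λ N → ∑ (λ j → P i j * x N j) - x N i)
      Px-x-null i = null-≗ (λ N → cong (_- x N i) (seq-∑ℝ (λ j → P i j · μ j) N)) (invariant i)

      -- For u = n - 1 the weight of staying is 0 and that of dropping is 1, so one step from the
      -- point mass `φ n` gives `φ u` itself.
      P≡φ : ∀ {u} → suc u ≡ n → ∀ i j → P i j ≡ φ u (i ∙ j ⁻¹)
      P≡φ {u} 1+u≡n i j = trans (P≡W i j) (trans (cong (λ k → W 1 k g) (sym 1+u≡n))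
        (trans (cong₂ (λ k d → ι⁻¹ n * (ι d * φ (suc u) g + ι k * φ u g)) 1+u≡n
            (trans (cong (n ℕ.∸_) 1+u≡n) (ℕ.n∸n≡0 n)))
          (trans (cong (λ z → ι⁻¹ n * (z * φ (suc u) g + ι n * φ u g)) ι-0)
          (trans (cong (ι⁻¹ n *_) (trans (cong (_+ ι n * φ u g) (ℚ.*-zeroˡ (φ (suc u) g))) (ℚ.+-identityˡ (ι n * φ u g))))
            (ι⁻¹-cancel n (φ u g))))))
        where
        g = i ∙ j ⁻¹

      -- `P` acts on the left variable of the convolution only, so `T-φ` applies to each translate
      -- separately.
      P-φ*x : ∀ {u} → suc u ℕ.≤ n → ∀ N i → ∑ (λ l → P i l * φ*x (suc u) N l) ≡ average u (φ*x (suc u) N i) (φ*x u N i)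
      P-φ*x {u} u<n N i = trans
        (sumOver-cong elements λ l → sym (sumOver-* elements (P i l) (λ j → φ (suc u) (l ∙ j ⁻¹) * x N j)))
        (trans (sumOver-swap elements elements (λ l j → P i l * (φ (suc u) (l ∙ j ⁻¹) * x N j)))
        (trans (sumOver-cong elements column)
        (trans (sumOver-* elements (ι⁻¹ n) (λ j → a * p j + b * q j))
          (cong (ι⁻¹ n *_) (trans (sumOver-+ elements (λ j → a * p j) (λ j → b * q j))
            (cong₂ _+_ (sumOver-* elements a p) (sumOver-* elements b q)))))))
        where
        p q : Element → ℚ
        p j = φ (suc u) (i ∙ j ⁻¹) * x N j
        q j = φ u (i ∙ j ⁻¹) * x N j
        a b : ℚ
        a = ι (n ℕ.∸ suc u)
        b = ι (suc u)
        distribute : ∀ c a b p q x → c * (a * p + b * q) * x ≡ c * (a * (p * x) + b * (q * x))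
        distribute = solve 6 (λ c a b p q x → c :* (a :* p :+ b :* q) :* x := c :* (a :* (p :* x) :+ b :* (q :* x))) refl
        column : ∀ j → ∑ (λ l → P i l * (φ (suc u) (l ∙ j ⁻¹) * x N j))
                 ≡ average u (φ (suc u) (i ∙ j ⁻¹) * x N j) (φ u (i ∙ j ⁻¹) * x N j)
        column j = trans (sumOver-cong elements λ l → trans (sym (ℚ.*-assoc (P i l) (φ (suc u) (l ∙ j ⁻¹)) (x N j)))
            (ℚ.*-comm (P i l * φ (suc u) (l ∙ j ⁻¹)) (x N j)))
          (trans (sumOver-* elements (x N j) (λ l → P i l * φ (suc u) (l ∙ j ⁻¹)))
          (trans (ℚ.*-comm (x N j) (∑ (λ l → P i l * φ (suc u) (l ∙ j ⁻¹))))
          (trans (cong (_* x N j) (trans (∑-P-translate (φ (suc u)) (φ-cong (suc u)) i j) (T-φ u<n (i ∙ j ⁻¹))))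
            (distribute (ι⁻¹ n) a b (φ (suc u) (i ∙ j ⁻¹)) (φ u (i ∙ j ⁻¹)) (x N j)))))

      -- If φ_{u+1} * μ = μ then μ = P μ = average u μ (φ_u * μ), hence φ_u * μ = μ.
      φ*x-x-null : ∀ d u → suc (d ℕ.+ u) ≡ n → ∀ i → Null (λ N → φ*x u N i - x N i)
      -- Here `d` is n - 1 - u, so that induction on `d` lowers `u` from n - 1 to 0.
      φ*x-x-null zero    u eq i = null-≗ (λ N → cong (_- x N i) (sumOver-cong elements λ j → cong (_* x N j) (P≡φ eq i j)))
        (Px-x-null i)
      φ*x-x-null (suc d) u eq i = null-≗ solve-for-φ*x
        (null-* c (null-+ (null-+ (null-sum elements λ l → null-* (P i l) (IH l)) (Px-x-null i)) (null-* (- a) (IH i))))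
        where
        u<n : suc u ℕ.≤ n
        u<n = subst (suc u ℕ.≤_) eq (ℕ.s≤s (ℕ.≤-trans (ℕ.m≤n+m u d) (ℕ.n≤1+n (d ℕ.+ u))))
        IH : ∀ l → Null (λ N → φ*x (suc u) N l - x N l)
        IH = φ*x-x-null d (suc u) (trans (cong suc (ℕ.+-suc d u)) eq)
        -- `a` is the weight of staying, and `c` is the inverse of the weight (u + 1) / n of
        -- dropping.
        a c : ℚ
        a = ι⁻¹ n * ι (n ℕ.∸ suc u)
        c = ι⁻¹ (suc u) * ι n

        solve-for-φ*x : ∀ N → c * (∑ (λ l → P i l * (φ*x (suc u) N l - x N l)) + (∑ (λ j → P i j * x N j) - x N i)
                              + - a * (φ*x (suc u) N i - x N i)) ≡ φ*x u N i - x N i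
        -- Once `X` is written as its own average, `Px` and the terms with `M′` cancel. What remains
        -- is (u + 1) / n times `M - X`, and `c` removes the factor.
        solve-for-φ*x N = trans (cong (λ z → c * (z + (Px - X) + - a * (M′ - X))) ∑-difference)
          (trans (cong (λ z → c * (average u M′ M - Px + (Px - z) + - a * (M′ - X))) (sym (average-const u<n X)))
          (trans (simplify (ι⁻¹ (suc u)) (ι n) (ι⁻¹ n) (ι (n ℕ.∸ suc u)) (ι (suc u)) M′ M Px X)
          (trans (cong (ι⁻¹ (suc u) *_) (trans (swap-cancel (ι n) (ι⁻¹ n) (ι (suc u) * (M - X))) (ι⁻¹-cancel n (ι (suc u) * (M - X)))))
            (ι⁻¹-cancel (suc u) (M - X)))))
          where
          X Px M M′ : ℚ
          X  = x N i
          Px = ∑ (λ j → P i j * x N j)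
          M  = φ*x u N i
          M′ = φ*x (suc u) N i
          ∑-difference : ∑ (λ l → P i l * (φ*x (suc u) N l - x N l)) ≡ average u M′ M - Px
          ∑-difference = trans (sumOver-cong elements λ l → spread (P i l) (φ*x (suc u) N l) (x N l))
            (trans (sumOver-+ elements (λ l → P i l * φ*x (suc u) N l) (λ l → - 1ℚ * (P i l * x N l)))
            (trans (cong₂ _+_ (P-φ*x u<n N i) (sumOver-* elements (- 1ℚ) (λ l → P i l * x N l)))
              (negate (average u M′ M) Px)))
            where
            spread : ∀ p y z → p * (y - z) ≡ p * y + - 1ℚ * (p * z)
            spread = solve 3 (λ p y z → p :* (y :- z) := p :* y :+ con (- 1ℚ) :* (p :* z)) refl
            negate : ∀ p q → p + - 1ℚ * q ≡ p - q
            negate = solve 2 (λ p q → p :+ con (- 1ℚ) :* q := p :- q) refl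
          simplify : ∀ s n n′ k u y z p x →
            s * n * (n′ * (k * y + u * z) - p + (p - n′ * (k * x + u * x)) + - (n′ * k) * (y - x)) ≡ s * (n * (n′ * (u * (z - x))))
          simplify = solve 9 (λ s n n′ k u y z p x →
            s :* n :* (n′ :* (k :* y :+ u :* z) :- p :+ (p :- n′ :* (k :* x :+ u :* x)) :+ :- (n′ :* k) :* (y :- x))
            := s :* (n :* (n′ :* (u :* (z :- x))))) refl
          swap-cancel : ∀ a b c → a * (b * c) ≡ b * (a * c)
          swap-cancel = solve 3 (λ a b c → a :* (b :* c) := b :* (a :* c)) refl

    -- As `φ 0` is constant, its convolution with `μ` is `1/∣G∣` times the total mass, which tends
    -- to 1.
    stationary⇒uniform : ∀ i → μ i ≃ uniform i
    stationary⇒uniform i = null-≗ combine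
      (null-+ (null-* (- 1ℚ) (φ*x-x-null (ℕ.pred n) 0 (trans (cong suc (ℕ.+-identityʳ (ℕ.pred n))) (ℕ.suc-pred n)) i))
              (null-* 1/∣G∣ total))
      where
      combine : ∀ N → - 1ℚ * (φ*x 0 N i - x N i) + 1/∣G∣ * (seq (∑ℝ μ) N - 1ℚ) ≡ x N i - 1/∣G∣
      combine N = trans (cong₂ (λ p q → - 1ℚ * (p - x N i) + 1/∣G∣ * (q - 1ℚ))
        (trans (sumOver-cong elements λ j → cong (_* x N j) (φ-0 (i ∙ j ⁻¹))) (sumOver-* elements 1/∣G∣ (x N)))
        (seq-∑ℝ μ N))
        (cancel 1/∣G∣ (∑ (x N)) (x N i))
        where
        cancel : ∀ v s x → - 1ℚ * (v * s - x) + v * (s - 1ℚ) ≡ x - v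
        cancel = solve 3 (λ v s x → con (- 1ℚ) :* (v :* s :- x) :+ v :* (s :- con 1ℚ) := x :- v) refl

mainTheorem2 : (m n : ℕ) .{{_ : NonZero m}} .{{_ : NonZero n}} →
    let open G[_,1,_] m n in
    IsDoublyStochastic P
    × Ergodic P
    × IsUniqueStationary P uniform
    × ∃[ α ] ( 0ℚ ℚ.< α
    × (m ≡ 1 → 2 ℕ.≤ n → ConvergesAtRate α ((+ n ℤ.- + 2) / n))
    × (1 ℕ.< m → ConvergesAtRate α ((+ n ℤ.- + 1) / n)))
mainTheorem2 m n =
  P-doublyStochastic , P-ergodic , (uniform-stationary , stationary⇒uniform) ,
  α , 0<α , rate[n-2]/n , (λ _ → rate[n-1]/n)
  where
  open Walk m n
  open Mixing m n
  open Conclusion m n
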